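{- There is no nfs-irreducible clause-irreducible unsatisfiable hitting clause-set of deficiency $3$. Equivalently: for every clause-irreducible unsatisfiable hitting clause-set $F$ with $\delta(F)=3$, there is a finite sequence of nfs-flips transforming $F$ into a clause-reducible clause-set.
   Context: Variables are positive integers, literals are nonzero integers, the complement of a literal $x$ is $\overline{x}=-x$, and $\mathrm{var}(x)=|x|$. A clause is a finite set $C$ of literals with no pair $x,\overline{x}$; $\bot$ is the empty clause. A clause-set is a finite set of clauses; $\top$ denotes the empty clause-set. $\mathrm{var}(F)$ is the set of variables occurring in $F$, $n(F)=|\mathrm{var}(F)|$, $c(F)=|F|$, $\delta(F)=c(F)-n(F)$. $F$ is satisfiable if some clause $C$ satisfies $C\cap D\ne\emptyset$ for all $D\in F$, otherwise unsatisfiable. $F$ is hitting if any two distinct clauses $C,D\in F$ have some $x\in C$ with $\overline{x}\in D$. A clause-factor is a clause-set $F'\neq\top$ such that the residue $\{C\setminus\bigcap F': C\in F'\}$ is unsatisfiable; a clause-factor of $F$ is a subset $F'\subseteq F$ that is a clause-factor. It is trivial if $c(F')=1$, or if $F'$ is unsatisfiable and $F'=F$; otherwise nontrivial. $F$ is clause-irreducible if all its clause-factors are trivial, otherwise clause-reducible. An nfs-pair is a set $\{E\cup\{x\},E\cup\{\overline{x},y\}\}$ of two clauses where $E$ is a clause, $x,y$ are literals with $\mathrm{var}(x)\ne\mathrm{var}(y)$ and $x,\overline x,y,\overline y\notin E$; its nfs-flip is $\{E\cup\{x,\overline{y}\},E\cup\{y\}\}$. Performing an nfs-flip on a clause-set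 $F$ means choosing an nfs-pair $P\subseteq F$ such that neither clause of its nfs-flip belongs to $F$, and replacing $P$ in $F$ by its nfs-flip. A clause-irreducible unsatisfiable hitting clause-set is nfs-reducible if some finite sequence of nfs-flips transforms it into a clause-reducible clause-set, and nfs-irreducible otherwise. -}

module Defs where

open import Data.Integer as ℤ using (ℤ; +_; -_; ∣_∣; _<_)
import Data.Integer.Properties as ℤP
open import Data.Nat as ℕ using (ℕ)
import Data.Nat.Properties as ℕP
open import Data.List using (List; []; _∷_; length; map; concat; filter; deduplicate)
open import Data.List.Membership.Propositional using (_∈_; _∉_)
open import Data.List.Membership.DecPropositional ℤP._≟_ using (_∈?_)
open import Data.List.Relation.Unary.All using (All; all?)
open import Data.List.Relation.Unary.AllPairs using (AllPairs)
open import Data.List.Relation.Unary.Unique.Propositional using (Unique)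
open import Data.List.Relation.Binary.Sublist.Propositional using (_⊆_)
open import Data.Product using (Σ; ∃; ∃-syntax; _×_)
open import Data.Sum using (_⊎_)
open import Relation.Nullary using (¬_)
open import Relation.Binary.PropositionalEquality using (_≡_; _≢_)
open import Relation.Binary.Construct.Closure.ReflexiveTransitive using (Star)

-- Literals are nonzero integers; the complement of x is - x; var x = ∣ x ∣.
-- A clause is represented canonically as a strictly increasing list of
-- nonzero integers without a complementary pair; thus two clauses are equal
-- as sets iff they are equal as lists (≡).
Clause : Set
Clause = List ℤ

IsClause : Clause → Set
IsClause C = AllPairs _<_ C × All (λ x → x ≢ + 0) C × (∀ x → x ∈ C → - x ∉ C)

-- A clause-set is a duplicate-free list of (canonical) clauses,
-- read as the finite set of its members.
ClauseSet : Set
ClauseSet = List Clause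

IsClauseSet : ClauseSet → Set
IsClauseSet F = All IsClause F × Unique F

Satisfiable : ClauseSet → Set
Satisfiable F = ∃[ C ] (IsClause C × (∀ D → D ∈ F → ∃[ x ] (x ∈ C × x ∈ D)))

Unsatisfiable : ClauseSet → Set
Unsatisfiable F = ¬ Satisfiable F

Hitting : ClauseSet → Set
Hitting F = ∀ C D → C ∈ F → D ∈ F → C ≢ D → ∃[ x ] (x ∈ C × - x ∈ D)

varList : ClauseSet → List ℕ
varList F = deduplicate ℕP._≟_ (map ∣_∣ (concat F))

nVars : ClauseSet → ℕ
nVars F = length (varList F)

nClauses : ClauseSet → ℕ
nClauses F = length F

deficiency : ClauseSet → ℤ
deficiency F = + nClauses F ℤ.- + nVars F

InAll : ClauseSet → ℤ → Set
InAll F' x = All (λ C → x ∈ C) F'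

residue : ClauseSet → ClauseSet
residue F' = map (λ C → filter (λ x → Relation.Nullary.¬? (all? (λ C' → x ∈? C') F')) C) F'
  where import Relation.Nullary

-- F' is a clause-factor of F: F' ⊆ F (as a sublist of the duplicate-free
-- list F, i.e. a subset), F' ≠ ⊤, and the residue is unsatisfiable.
IsClauseFactorOf : ClauseSet → ClauseSet → Set
IsClauseFactorOf F' F = F' ⊆ F × F' ≢ [] × Unsatisfiable (residue F')

-- trivial: c(F') = 1, or F' unsatisfiable and F' = F (as sets)
Trivial : ClauseSet → ClauseSet → Set
Trivial F' F = (length F' ≡ 1) ⊎ (Unsatisfiable F' × (∀ C → C ∈ F → C ∈ F'))

ClauseIrreducible : ClauseSet → Set
ClauseIrreducible F = ∀ F' → IsClauseFactorOf F' F → Trivial F' F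

ClauseReducible : ClauseSet → Set
ClauseReducible F = ∃[ F' ] (IsClauseFactorOf F' F × ¬ Trivial F' F)

-- One nfs-flip step F ⟶ G.  The nfs-pair is P1 = E ∪ {x}, P2 = E ∪ {x̄, y},
-- its flip is Q1 = E ∪ {x, ȳ}, Q2 = E ∪ {y}; P1, P2 ∈ F, Q1, Q2 ∉ F, and
-- G = (F ∖ {P1, P2}) ∪ {Q1, Q2} as sets.
NfsStep : ClauseSet → ClauseSet → Set
NfsStep F G =
  ∃[ E ] ∃[ x ] ∃[ y ] ∃[ P1 ] ∃[ P2 ] ∃[ Q1 ] ∃[ Q2 ]
    ( IsClause E × x ≢ + 0 × y ≢ + 0 × ∣ x ∣ ≢ ∣ y ∣
    × x ∉ E × - x ∉ E × y ∉ E × - y ∉ E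
    × IsClause P1 × IsClause P2 × IsClause Q1 × IsClause Q2
    × (∀ z → (z ∈ P1 → z ∈ E ⊎ z ≡ x) × (z ∈ E ⊎ z ≡ x → z ∈ P1))
    × (∀ z → (z ∈ P2 → z ∈ E ⊎ z ≡ - x ⊎ z ≡ y) × (z ∈ E ⊎ z ≡ - x ⊎ z ≡ y → z ∈ P2))
    × (∀ z → (z ∈ Q1 → z ∈ E ⊎ z ≡ x ⊎ z ≡ - y) × (z ∈ E ⊎ z ≡ x ⊎ z ≡ - y → z ∈ Q1))
    × (∀ z → (z ∈ Q2 → z ∈ E ⊎ z ≡ y) × (z ∈ E ⊎ z ≡ y → z ∈ Q2))
    × P1 ∈ F × P2 ∈ F × Q1 ∉ F × Q2 ∉ F
    × IsClauseSet G
    × (∀ C → (C ∈ G → (C ∈ F × C ≢ P1 × C ≢ P2) ⊎ C ≡ Q1 ⊎ C ≡ Q2)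
           × ((C ∈ F × C ≢ P1 × C ≢ P2) ⊎ C ≡ Q1 ⊎ C ≡ Q2 → C ∈ G)))

NfsFlips : ClauseSet → ClauseSet → Set
NfsFlips = Star NfsStep

{-# OPTIONS --safe #-}

-- A consistent list of literals is read as the partial assignment making them
-- false. Tarsi's argument, splitting on a variable of minimal degree, gives
-- c(F) > n(F) for unsatisfiable hitting F, and a variable of degree at most 5
-- in deficiency 3: both literals of a variable of minimal degree occur at most
-- three times, and if both occur exactly three times, then splitting leaves
-- deficiency 1, hence a variable of degree at most 2 + 3.
--
-- So some literal x occurs at most twice and - x at most three times. If x
-- occurs once, the clauses with - x form a clause-factor, possibly together with
-- the clause with x. Otherwise let the two clauses be A₁ ∪ {x , y} and
-- A₂ ∪ {x , - y}. The clauses with - x partition the subcube of A₁ on the side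
-- of y and that of A₂ on the side of - y. With three clauses there are only few
-- such partitions, and each yields a clause-factor at once or after a flip that
-- creates the mirror image of one of the two clauses with x.

module Submission where

open import Defs
open import Data.Integer as ℤ using (ℤ; +_; -_; ∣_∣; _<_; -[1+_])
import Data.Integer.Properties as ℤP
open import Data.Nat as ℕ using (ℕ; zero; suc; z≤n; s≤s; _≤_)
import Data.Nat.Properties as ℕP
import Algebra.Properties.CommutativeSemigroup ℕP.+-commutativeSemigroup as ℕ+
open import Data.List using (List; []; _∷_; length; map; filter; foldr; concat; _++_)
open import Data.List.Properties using (≡-dec; filter-none; filter-all; filter-notAll)
open import Data.List.Membership.Propositional using (_∈_; _∉_; lose; find)
open import Data.List.Membership.DecPropositional ℤP._≟_ using (_∈?_)
open import Data.List.Membership.Propositional.Properties using (∈-filter⁺; ∈-filter⁻; ∈-map⁺; ∈-map⁻; ∈-++⁺ˡ; ∈-++⁺ʳ; ∈-++⁻; ∈-concat⁺′; ∈-concat⁻′; ∈-deduplicate⁺; ∈-deduplicate⁻)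
open import Data.List.Relation.Binary.Subset.Propositional using () renaming (_⊆_ to _⊑_)
open import Data.List.Relation.Binary.Sublist.Propositional using (_⊆_; ⊆-trans)
open import Data.List.Relation.Binary.Sublist.Propositional.Properties using (filter-⊆)
open import Data.List.Relation.Unary.All as All using (All; []; _∷_; all?)
open import Data.List.Relation.Unary.AllPairs using (AllPairs; []; _∷_)
import Data.List.Relation.Unary.AllPairs.Properties as AllPairsP
open import Data.List.Relation.Unary.Any using (here; there; any?)
open import Data.List.Relation.Unary.Unique.Propositional using (Unique)
import Data.List.Relation.Unary.Unique.Propositional.Properties as UniqueP
open import Data.List.Relation.Unary.Unique.DecPropositional.Properties ℕP._≟_ using (deduplicate-!)
open import Data.Empty using (⊥; ⊥-elim)
open import Data.Product using (∃-syntax; _×_; _,_; proj₁; proj₂)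
open import Data.Sum using (_⊎_; inj₁; inj₂; [_,_]′)
open import Function using (_∘_; id)
open import Relation.Binary.Definitions using (DecidableEquality; tri<; tri≈; tri>)
open import Relation.Binary.Construct.Closure.ReflexiveTransitive using (ε; _◅_)
open import Relation.Binary.PropositionalEquality using (_≡_; _≢_; refl; sym; trans; cong; cong₂; subst; module ≡-Reasoning)
open import Relation.Nullary using (¬_; yes; no; ¬?; _×-dec_; _⊎-dec_)
open import Relation.Unary using (Decidable)

-- Consistent lists of literals

private
  variable
    C D S Γ : List ℤ
    F G : ClauseSet
    u w x y z : ℤ

_≟ᶜ_ : DecidableEquality Clause
_≟ᶜ_ = ≡-dec ℤP._≟_

-- For consistent D and S: the partial assignment S can be extended to an
-- assignment falsifying D.
Compat : List ℤ → List ℤ → Set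
Compat D S = ∀ x → x ∈ D → - x ∉ S

Con : List ℤ → Set
Con S = Compat S S

-- Semantically: once the literals of `Γ` are false, no consistent extension satisfies every clause
-- of `G`. Phrasing it by compatibility avoids total assignments.
Covers : List ℤ → ClauseSet → Set
Covers Γ G = ∀ S → Con S → Γ ⊑ S → ∃[ D ] (D ∈ G × Compat D S)

-‿swap : x ≡ - y → - x ≡ y
-‿swap {y = y} refl = ℤP.neg-involutive y

-x≡x⇒x≡0 : ∀ x → - x ≡ x → x ≡ + 0
-x≡x⇒x≡0 (+ zero) e = refl
-x≡x⇒x≡0 (+ suc n) ()
-x≡x⇒x≡0 (-[1+ n ]) ()

∣x∣≡∣y∣⇒x≡±y : ∀ x y → ∣ x ∣ ≡ ∣ y ∣ → x ≡ y ⊎ x ≡ - y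
∣x∣≡∣y∣⇒x≡±y (+ m) (+ n) refl = inj₁ refl
∣x∣≡∣y∣⇒x≡±y (+ m) (-[1+ n ]) refl = inj₂ refl
∣x∣≡∣y∣⇒x≡±y (-[1+ m ]) (+ n) refl = inj₂ refl
∣x∣≡∣y∣⇒x≡±y (-[1+ m ]) (-[1+ n ]) refl = inj₁ refl

con⇒≢0 : Con S → x ∈ S → x ≢ + 0
con⇒≢0 con x∈S refl = con (+ 0) x∈S x∈S

con-⊥ : Con S → x ∈ S → y ∈ S → y ≡ - x → ⊥
con-⊥ con x∈S y∈S refl = con _ x∈S y∈S

compat-⊥ : Compat D S → x ∈ D → y ∈ S → x ≡ - y → ⊥
compat-⊥ {S = S} {y = y} cp x∈D y∈S refl =
  cp _ x∈D (subst (_∈ S) (sym (ℤP.neg-involutive y)) y∈S)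

con-∷ : x ≢ + 0 → - x ∉ S → Con S → Con (x ∷ S)
con-∷ x≢0 -x∉S con z (here refl) (here e) = x≢0 (-x≡x⇒x≡0 z e)
con-∷ x≢0 -x∉S con z (here refl) (there q) = -x∉S q
con-∷ {S = S} x≢0 -x∉S con z (there p) (here e) = -x∉S (subst (_∈ S) (sym (-‿swap (sym e))) p)
con-∷ x≢0 -x∉S con z (there p) (there q) = con z p q

con-neg∷ : x ≢ + 0 → x ∉ S → Con S → Con (- x ∷ S)
con-neg∷ {x = x} {S = S} x≢0 x∉S =
  con-∷ (λ e → x≢0 (ℤP.neg-injective {x} {+ 0} e)) (x∉S ∘ subst (_∈ S) (ℤP.neg-involutive x))

con-⊑ : D ⊑ S → Con S → Con D
con-⊑ D⊑S con x p q = con x (D⊑S p) (D⊑S q)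

-- Deletion of a literal and canonical clauses

infixl 6 _∖_
_∖_ : List ℤ → ℤ → List ℤ
C ∖ x = filter (λ a → ¬? (a ℤP.≟ x)) C

∖⁺ : ∀ {a} → a ∈ C → a ≢ x → a ∈ C ∖ x
∖⁺ = ∈-filter⁺ _

∖⁻ : ∀ {a} → a ∈ C ∖ x → a ∈ C × a ≢ x
∖⁻ = ∈-filter⁻ _

∖-⊑ : C ∖ x ⊑ C
∖-⊑ = proj₁ ∘ ∖⁻

insert : ℤ → List ℤ → List ℤ
insert z [] = z ∷ []
insert z (a ∷ C) with ℤP.<-cmp z a
... | tri< _ _ _ = z ∷ a ∷ C
... | tri≈ _ _ _ = a ∷ C
... | tri> _ _ _ = a ∷ insert z C

∈-insert⁺ : ∀ {a} z C → a ≡ z ⊎ a ∈ C → a ∈ insert z C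
∈-insert⁺ z [] (inj₁ e) = here e
∈-insert⁺ z (b ∷ C) p with ℤP.<-cmp z b
∈-insert⁺ z (b ∷ C) (inj₁ e) | tri< _ _ _ = here e
∈-insert⁺ z (b ∷ C) (inj₂ p) | tri< _ _ _ = there p
∈-insert⁺ z (b ∷ C) (inj₁ e) | tri≈ _ z≡b _ = here (trans e z≡b)
∈-insert⁺ z (b ∷ C) (inj₂ p) | tri≈ _ _ _ = p
∈-insert⁺ z (b ∷ C) (inj₁ e) | tri> _ _ _ = there (∈-insert⁺ z C (inj₁ e))
∈-insert⁺ z (b ∷ C) (inj₂ (here e)) | tri> _ _ _ = here e
∈-insert⁺ z (b ∷ C) (inj₂ (there p)) | tri> _ _ _ = there (∈-insert⁺ z C (inj₂ p))

∈-insert⁻ : ∀ {a} z C → a ∈ insert z C → a ≡ z ⊎ a ∈ C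
∈-insert⁻ z [] (here e) = inj₁ e
∈-insert⁻ z (b ∷ C) p with ℤP.<-cmp z b
∈-insert⁻ z (b ∷ C) (here e) | tri< _ _ _ = inj₁ e
∈-insert⁻ z (b ∷ C) (there p) | tri< _ _ _ = inj₂ p
∈-insert⁻ z (b ∷ C) p | tri≈ _ _ _ = inj₂ p
∈-insert⁻ z (b ∷ C) (here e) | tri> _ _ _ = inj₂ (here e)
∈-insert⁻ z (b ∷ C) (there p) | tri> _ _ _ with ∈-insert⁻ z C p
... | inj₁ e = inj₁ e
... | inj₂ q = inj₂ (there q)

insert-sorted : ∀ z → AllPairs _<_ C → AllPairs _<_ (insert z C)
insert-sorted z [] = [] ∷ []
insert-sorted {b ∷ C} z (b<C ∷ sorted) with ℤP.<-cmp z b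
... | tri< z<b _ _ = (z<b ∷ All.map (ℤP.<-trans z<b) b<C) ∷ b<C ∷ sorted
... | tri≈ _ _ _ = b<C ∷ sorted
... | tri> _ _ b<z = All.tabulate b<insert ∷ insert-sorted z sorted
  where
  b<insert : ∀ {a} → a ∈ insert z C → b < a
  b<insert p with ∈-insert⁻ z C p
  ... | inj₁ refl = b<z
  ... | inj₂ q = All.lookup b<C q

-- Flips create new clauses, which have to be strictly increasing lists; sorting by insertion
-- supplies them, and only membership matters afterwards.
canon : List ℤ → Clause
canon = foldr insert []

∈-canon⁺ : ∀ {a} S → a ∈ S → a ∈ canon S
∈-canon⁺ (z ∷ S) (here e) = ∈-insert⁺ z (canon S) (inj₁ e)
∈-canon⁺ (z ∷ S) (there p) = ∈-insert⁺ z (canon S) (inj₂ (∈-canon⁺ S p))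

∈-canon⁻ : ∀ {a} S → a ∈ canon S → a ∈ S
∈-canon⁻ (z ∷ S) p with ∈-insert⁻ z (canon S) p
... | inj₁ e = here e
... | inj₂ q = there (∈-canon⁻ S q)

canon-sorted : ∀ S → AllPairs _<_ (canon S)
canon-sorted [] = []
canon-sorted (z ∷ S) = insert-sorted z (canon-sorted S)

isClause-canon : Con S → IsClause (canon S)
isClause-canon {S} con =
  canon-sorted S ,
  All.tabulate (λ p → con⇒≢0 con (∈-canon⁻ S p)) ,
  λ x p q → con x (∈-canon⁻ S p) (∈-canon⁻ S q)

-- Unsatisfiability as covering

con-map-neg : Con S → Con (map -_ S)
con-map-neg con x p q with ∈-map⁻ -_ p | ∈-map⁻ -_ q
... | a , a∈S , refl | b , b∈S , e = con-⊥ con a∈S b∈S (sym (ℤP.neg-injective e))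

-- The literals in `S` are false, so their negations are true. If no clause were compatible with
-- `S`, the canonical clause of these negations would meet every clause of `F`.
unsat⇒covers : Unsatisfiable F → Covers [] F
unsat⇒covers {F} unsat S con _ with any? (λ D → all? (λ z → ¬? (- z ∈? S)) D) F
... | yes found with find found
...   | D , D∈F , ok = D , D∈F , λ x → All.lookup ok
unsat⇒covers {F} unsat S con _ | no none =
  ⊥-elim (unsat (canon (map -_ S) , isClause-canon (con-map-neg con) , hits))
  where
  hits : ∀ D → D ∈ F → ∃[ x ] (x ∈ canon (map -_ S) × x ∈ D)
  hits D D∈F with any? (λ z → - z ∈? S) D
  ... | yes found with find found
  ...   | z , z∈D , -z∈S =
    z , ∈-canon⁺ _ (subst (_∈ map -_ S) (ℤP.neg-involutive z) (∈-map⁺ -_ -z∈S)) , z∈D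
  hits D D∈F | no notfound =
    ⊥-elim (none (lose D∈F (All.tabulate (λ z∈D -z∈S → notfound (lose z∈D -z∈S)))))

-- A clause D compatible with S but without - x would be falsified together with
-- C after flipping x back, which hitting forbids.
mirror : Hitting G → Covers Γ G → C ∈ G → x ∈ C → Con S → Γ ⊑ S →
         C ∖ x ⊑ S → - x ∈ S → ∃[ D ] (D ∈ G × - x ∈ D × Compat D S)
mirror {C = C} {x = x} {S = S} hit cov C∈G x∈C con Γ⊑S C∖x⊑S -x∈S with cov S con Γ⊑S
... | D , D∈G , cp with hit C D C∈G D∈G (λ { refl → cp x x∈C -x∈S })
...   | z , z∈C , -z∈D with z ℤP.≟ x
...     | yes refl = D , D∈G , -z∈D , cp
...     | no z≢x = ⊥-elim (compat-⊥ cp -z∈D (C∖x⊑S (∖⁺ z∈C z≢x)) refl)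

-- A literal of `C` outside `Γ` could be made true, and then nothing would be left to cover the
-- extended assignment.
cover₁ : Covers Γ (C ∷ []) → Con Γ → Con C → C ⊑ Γ
cover₁ {Γ} cov conΓ conC {w} w∈C with w ∈? Γ
... | yes w∈Γ = w∈Γ
... | no w∉Γ with cov (- w ∷ Γ) (con-neg∷ (con⇒≢0 conC w∈C) w∉Γ conΓ) there
...   | _ , here refl , cp = ⊥-elim (cp w w∈C (here refl))

-- Falsifying `u` satisfies `D`, so that `C` has to cover `u ∷ Γ` alone, as in `cover₁`.
cover₂ : Covers Γ (C ∷ D ∷ []) → Con Γ → Con C → u ∈ C → - u ∈ D → - u ∉ Γ → C ⊑ u ∷ Γ
cover₂ {Γ} {u = u} cov conΓ conC u∈C -u∈D -u∉Γ {w} w∈C with w ∈? (u ∷ Γ)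
... | yes w∈ = w∈
... | no w∉ with cov (- w ∷ u ∷ Γ)
                     (con-neg∷ (con⇒≢0 conC w∈C) w∉ (con-∷ (con⇒≢0 conC u∈C) -u∉Γ conΓ))
                     (there ∘ there)
...   | _ , here refl , cp = ⊥-elim (cp w w∈C (here refl))
...   | _ , there (here refl) , cp = ⊥-elim (compat-⊥ cp -u∈D (there (here refl)) refl)

-- Clause-factors

-- `A` lies in the intersection of the clauses of `F′`, so a clause satisfying the residue would
-- yield an assignment that falsifies `A` and satisfies all of `F′`. The clause `R` witnesses that
-- the factor is proper.
factor⇒reducible : ∀ {F′ A R} → F′ ⊆ F → length F′ ≢ 1 → R ∈ F → R ∉ F′ →
                   Con A → (∀ C → C ∈ F′ → Con C × A ⊑ C) → Covers A F′ →
                   ClauseReducible F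
factor⇒reducible {F} {F′} {A} {R} F′⊆F len≢1 R∈F R∉F′ conA above cov =
  F′ , (F′⊆F , nonempty , unsat) , nontrivial
  where
  nontrivial : ¬ Trivial F′ F
  nontrivial (inj₁ len≡1) = len≢1 len≡1
  nontrivial (inj₂ (_ , F⊑F′)) = R∉F′ (F⊑F′ R R∈F)
  nonempty : F′ ≢ []
  nonempty refl with cov A conA id
  ... | _ , () , _
  outside? : Decidable (λ z → z ∉ A × - z ∉ A)
  outside? z = ¬? (z ∈? A) ×-dec ¬? (- z ∈? A)
  unsat : Unsatisfiable (residue F′)
  unsat (C , (_ , _ , conC) , hits) = conflict
    where
    -- The negated satisfying clause is cut down to variables outside `A`, which makes its union
    -- with `A` consistent.
    C₀ : List ℤ
    C₀ = filter outside? (map -_ C)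
    conC₀ : Con C₀
    conC₀ = con-⊑ (proj₁ ∘ ∈-filter⁻ outside?) (con-map-neg conC)
    con : Con (C₀ ++ A)
    con x p q with ∈-++⁻ C₀ p | ∈-++⁻ C₀ q
    ... | inj₁ p₁ | inj₁ q₁ = conC₀ x p₁ q₁
    ... | inj₁ p₁ | inj₂ q₂ = proj₂ (proj₂ (∈-filter⁻ outside? {xs = map -_ C} p₁)) q₂
    ... | inj₂ p₂ | inj₁ q₁ = proj₂ (proj₂ (∈-filter⁻ outside? {xs = map -_ C} q₁))
                                (subst (_∈ A) (sym (ℤP.neg-involutive x)) p₂)
    ... | inj₂ p₂ | inj₂ q₂ = conA x p₂ q₂
    conflict : ⊥
    conflict with cov (C₀ ++ A) con (∈-++⁺ʳ C₀)
    ... | D , D∈F′ , cp with hits _ (∈-map⁺ _ D∈F′)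
    ...   | z , z∈C , z∈res with ∈-filter⁻ _ z∈res
    ...     | z∈D , z∉all =
      cp z z∈D (∈-++⁺ˡ (∈-filter⁺ outside? (∈-map⁺ -_ z∈C) (-z∉A , z∉A)))
      where
      conD = proj₁ (above D D∈F′)
      A⊑D = proj₂ (above D D∈F′)
      -z∉A : - z ∉ A
      -z∉A p = conD z z∈D (A⊑D p)
      z∉A : - (- z) ∉ A
      -- A literal of `A` belongs to every clause of `F′`, hence was deleted in the residue.
      z∉A p = z∉all (All.tabulate λ {E} E∈F′ →
        proj₂ (above E E∈F′) (subst (_∈ A) (ℤP.neg-involutive z) p))

¬singleton : ∀ {A : Set} {a b : A} {as} → a ∈ as → b ∈ as → a ≢ b → length as ≢ 1
¬singleton {as = _ ∷ []} (here refl) (here refl) a≢b _ = a≢b refl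

-- `P` and `Q` differ only in the sign of `z`, so their residue consists of two complementary unit
-- clauses.
pair⇒reducible : ∀ {P Q R} → P ∈ F → Q ∈ F → R ∈ F → R ≢ P → R ≢ Q → Con P → Con Q →
                 z ∈ P → - z ∈ Q → P ∖ z ⊑ Q → Q ∖ - z ⊑ P → ClauseReducible F
pair⇒reducible {F} {z} {P} {Q} {R} P∈F Q∈F R∈F R≢P R≢Q conP conQ z∈P -z∈Q P⊑Q Q⊑P =
  factor⇒reducible (filter-⊆ isPQ? F)
    (¬singleton P∈F′ Q∈F′ (λ { refl → conP z z∈P -z∈Q }))
    R∈F ([ R≢P , R≢Q ]′ ∘ proj₂ ∘ ∈-filter⁻ isPQ? {xs = F})
    (con-⊑ ∖-⊑ conP) above cover
  where
  isPQ? : Decidable (λ C → C ≡ P ⊎ C ≡ Q)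
  isPQ? C = (C ≟ᶜ P) ⊎-dec (C ≟ᶜ Q)
  F′ = filter isPQ? F
  P∈F′ : P ∈ F′
  P∈F′ = ∈-filter⁺ isPQ? P∈F (inj₁ refl)
  Q∈F′ : Q ∈ F′
  Q∈F′ = ∈-filter⁺ isPQ? Q∈F (inj₂ refl)
  above : ∀ C → C ∈ F′ → Con C × P ∖ z ⊑ C
  above C C∈F′ with proj₂ (∈-filter⁻ isPQ? {xs = F} C∈F′)
  ... | inj₁ refl = conP , ∖-⊑
  ... | inj₂ refl = conQ , P⊑Q
  cover : Covers (P ∖ z) F′
  cover S con P∖z⊑S with - z ∈? S
  ... | no -z∉S = P , P∈F′ , compatP
    where
    compatP : Compat P S
    compatP a a∈P with a ℤP.≟ z
    ... | yes refl = -z∉S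
    ... | no a≢z = con a (P∖z⊑S (∖⁺ a∈P a≢z))
  ... | yes -z∈S = Q , Q∈F′ , compatQ
    where
    compatQ : Compat Q S
    compatQ a a∈Q with a ℤP.≟ - z
    ... | yes refl = con (- z) -z∈S
    ... | no a≢-z = con a (P∖z⊑S (∖⁺ (Q⊑P (∖⁺ a∈Q a≢-z))
                            (λ { refl → conQ a a∈Q -z∈Q })))

-- Flips

-- In a hitting clause-set a flip is never blocked: each new clause differs from `P₁` over the
-- variable of `y` but does not clash with it, so it cannot already be in `F`. The common part of
-- the nfs-pair is `P₁` without `u`.
flip : ∀ {P₁ P₂} → IsClauseSet F → Hitting F → P₁ ∈ F → P₂ ∈ F →
       u ∈ P₁ → - u ∈ P₂ → y ∈ P₂ → y ∉ P₁ → - y ∉ P₁ → P₁ ∖ u ⊑ P₂ → P₂ ∖ - u ∖ y ⊑ P₁ →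
       ∃[ G ] (NfsFlips F G × (∀ C → C ∈ G → Con C)
         × (∀ C → C ∈ F → C ≢ P₁ → C ≢ P₂ → C ∈ G)
         × canon (- y ∷ P₁) ∈ G × canon (y ∷ P₁ ∖ u) ∈ G
         × canon (- y ∷ P₁) ∉ F × canon (y ∷ P₁ ∖ u) ∉ F)
flip {F} {u} {y} {P₁} {P₂} (clauses , unique) hit P₁∈F P₂∈F u∈P₁ -u∈P₂ y∈P₂ y∉P₁ -y∉P₁ P₁⊑P₂ P₂⊑P₁ =
  H , step ◅ ε , (λ C C∈H → proj₂ (proj₂ (All.lookup (proj₁ isClauseSetH) C∈H))) ,
  (λ C C∈F C≢P₁ C≢P₂ → there (there (∈-filter⁺ other? C∈F (C≢P₁ , C≢P₂)))) ,
  here refl , there (here refl) , Q₁∉F , Q₂∉F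
  where
  E Q₁ Q₂ : List ℤ
  E = P₁ ∖ u
  Q₁ = canon (- y ∷ P₁)
  Q₂ = canon (y ∷ E)
  other? : Decidable (λ C → C ≢ P₁ × C ≢ P₂)
  other? C = ¬? (C ≟ᶜ P₁) ×-dec ¬? (C ≟ᶜ P₂)
  H : ClauseSet
  H = Q₁ ∷ Q₂ ∷ filter other? F
  isClauseP₁ : IsClause P₁
  isClauseP₁ = All.lookup clauses P₁∈F
  isClauseP₂ : IsClause P₂
  isClauseP₂ = All.lookup clauses P₂∈F
  conP₁ : Con P₁
  conP₁ = proj₂ (proj₂ isClauseP₁)
  conP₂ : Con P₂
  conP₂ = proj₂ (proj₂ isClauseP₂)
  y≢0 : y ≢ + 0
  y≢0 = con⇒≢0 conP₂ y∈P₂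
  conE : Con E
  conE = con-⊑ ∖-⊑ conP₁
  isClauseQ₁ : IsClause Q₁
  isClauseQ₁ = isClause-canon (con-neg∷ y≢0 y∉P₁ conP₁)
  isClauseQ₂ : IsClause Q₂
  isClauseQ₂ = isClause-canon (con-∷ y≢0 (-y∉P₁ ∘ ∖-⊑) conE)
  y∈Q₂ : y ∈ Q₂
  y∈Q₂ = ∈-canon⁺ (y ∷ E) (here refl)
  -y∈Q₁ : - y ∈ Q₁
  -y∈Q₁ = ∈-canon⁺ (- y ∷ P₁) (here refl)
  Q₁∉F : Q₁ ∉ F
  Q₁∉F Q₁∈F with hit Q₁ P₁ Q₁∈F P₁∈F (λ e → -y∉P₁ (subst (- y ∈_) e -y∈Q₁))
  ... | z , z∈Q₁ , -z∈P₁ with ∈-canon⁻ (- y ∷ P₁) z∈Q₁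
  ...   | here refl = y∉P₁ (subst (_∈ P₁) (ℤP.neg-involutive y) -z∈P₁)
  ...   | there z∈P₁ = conP₁ z z∈P₁ -z∈P₁
  Q₂∉F : Q₂ ∉ F
  Q₂∉F Q₂∈F with hit Q₂ P₁ Q₂∈F P₁∈F (λ e → y∉P₁ (subst (y ∈_) e y∈Q₂))
  ... | z , z∈Q₂ , -z∈P₁ with ∈-canon⁻ (y ∷ E) z∈Q₂
  ...   | here refl = -y∉P₁ -z∈P₁
  ...   | there z∈E = conP₁ z (∖-⊑ z∈E) -z∈P₁
  Q₁≢Q₂ : Q₁ ≢ Q₂
  Q₁≢Q₂ e = proj₂ (proj₂ isClauseQ₂) y y∈Q₂ (subst (- y ∈_) e -y∈Q₁)
  isClauseSetH : IsClauseSet H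
  isClauseSetH =
    (isClauseQ₁ ∷ isClauseQ₂ ∷ All.tabulate (All.lookup clauses ∘ proj₁ ∘ ∈-filter⁻ other? {xs = F})) ,
    ((Q₁≢Q₂ ∷ All.tabulate (λ { p refl → Q₁∉F (proj₁ (∈-filter⁻ other? {xs = F} p)) })) ∷
     All.tabulate (λ { p refl → Q₂∉F (proj₁ (∈-filter⁻ other? {xs = F} p)) }) ∷
     UniqueP.filter⁺ other? unique)
  ∣u∣≢∣y∣ : ∣ u ∣ ≢ ∣ y ∣
  ∣u∣≢∣y∣ e with ∣x∣≡∣y∣⇒x≡±y u y e
  ... | inj₁ refl = y∉P₁ u∈P₁
  ... | inj₂ refl = -y∉P₁ u∈P₁
  P₁⇔ : ∀ z → (z ∈ P₁ → z ∈ E ⊎ z ≡ u) × (z ∈ E ⊎ z ≡ u → z ∈ P₁)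
  P₁⇔ z = to , [ ∖-⊑ , (λ { refl → u∈P₁ }) ]′
    where
    to : z ∈ P₁ → z ∈ E ⊎ z ≡ u
    to p with z ℤP.≟ u
    ... | yes e = inj₂ e
    ... | no z≢u = inj₁ (∖⁺ p z≢u)
  P₂⇔ : ∀ z → (z ∈ P₂ → z ∈ E ⊎ z ≡ - u ⊎ z ≡ y) × (z ∈ E ⊎ z ≡ - u ⊎ z ≡ y → z ∈ P₂)
  P₂⇔ z = to , [ P₁⊑P₂ , [ (λ { refl → -u∈P₂ }) , (λ { refl → y∈P₂ }) ]′ ]′
    where
    to : z ∈ P₂ → z ∈ E ⊎ z ≡ - u ⊎ z ≡ y
    to p with z ℤP.≟ - u | z ℤP.≟ y
    ... | yes e | _ = inj₂ (inj₁ e)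
    ... | no _ | yes e = inj₂ (inj₂ e)
    ... | no z≢-u | no z≢y =
      inj₁ (∖⁺ (P₂⊑P₁ (∖⁺ (∖⁺ p z≢-u) z≢y)) (λ { refl → conP₂ z p -u∈P₂ }))
  Q₁⇔ : ∀ z → (z ∈ Q₁ → z ∈ E ⊎ z ≡ u ⊎ z ≡ - y) × (z ∈ E ⊎ z ≡ u ⊎ z ≡ - y → z ∈ Q₁)
  Q₁⇔ z = to , ∈-canon⁺ (- y ∷ P₁) ∘
          [ there ∘ ∖-⊑ , [ (λ { refl → there u∈P₁ }) , here ]′ ]′
    where
    to : z ∈ Q₁ → z ∈ E ⊎ z ≡ u ⊎ z ≡ - y
    to p with ∈-canon⁻ (- y ∷ P₁) p
    ... | here e = inj₂ (inj₂ e)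
    ... | there q with proj₁ (P₁⇔ z) q
    ...   | inj₁ r = inj₁ r
    ...   | inj₂ e = inj₂ (inj₁ e)
  Q₂⇔ : ∀ z → (z ∈ Q₂ → z ∈ E ⊎ z ≡ y) × (z ∈ E ⊎ z ≡ y → z ∈ Q₂)
  Q₂⇔ z = to , ∈-canon⁺ (y ∷ E) ∘ [ there , here ]′
    where
    to : z ∈ Q₂ → z ∈ E ⊎ z ≡ y
    to p with ∈-canon⁻ (y ∷ E) p
    ... | here e = inj₂ e
    ... | there q = inj₁ q
  H⇔ : ∀ C → (C ∈ H → (C ∈ F × C ≢ P₁ × C ≢ P₂) ⊎ C ≡ Q₁ ⊎ C ≡ Q₂)
           × ((C ∈ F × C ≢ P₁ × C ≢ P₂) ⊎ C ≡ Q₁ ⊎ C ≡ Q₂ → C ∈ H)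
  H⇔ C = to , from
    where
    to : C ∈ H → (C ∈ F × C ≢ P₁ × C ≢ P₂) ⊎ C ≡ Q₁ ⊎ C ≡ Q₂
    to (here e) = inj₂ (inj₁ e)
    to (there (here e)) = inj₂ (inj₂ e)
    to (there (there p)) = inj₁ (∈-filter⁻ other? {xs = F} p)
    from : (C ∈ F × C ≢ P₁ × C ≢ P₂) ⊎ C ≡ Q₁ ⊎ C ≡ Q₂ → C ∈ H
    from (inj₁ (p , n)) = there (there (∈-filter⁺ other? p n))
    from (inj₂ (inj₁ e)) = here e
    from (inj₂ (inj₂ e)) = there (here e)
  step : NfsStep F H
  step = E , u , y , P₁ , P₂ , Q₁ , Q₂ ,
    (AllPairsP.filter⁺ _ (proj₁ isClauseP₁) , All.tabulate (con⇒≢0 conE) , conE) ,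
    con⇒≢0 conP₁ u∈P₁ , y≢0 , ∣u∣≢∣y∣ ,
    (λ p → proj₂ (∖⁻ {C = P₁} p) refl) , conP₁ u u∈P₁ ∘ ∖-⊑ , y∉P₁ ∘ ∖-⊑ , -y∉P₁ ∘ ∖-⊑ ,
    isClauseP₁ , isClauseP₂ , isClauseQ₁ , isClauseQ₂ , P₁⇔ , P₂⇔ , Q₁⇔ , Q₂⇔ ,
    P₁∈F , P₂∈F , Q₁∉F , Q₂∉F , isClauseSetH , H⇔

-- Degrees

module _ {A : Set} {P : A → Set} (P? : Decidable P) where

  length-filter-¬ : ∀ as → length (filter P? as) ℕ.+ length (filter (¬? ∘ P?) as) ≡ length as
  length-filter-¬ [] = refl
  length-filter-¬ (a ∷ as) with P? a
  ... | yes _ = cong suc (length-filter-¬ as)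
  ... | no _ = trans (ℕP.+-suc _ _) (cong suc (length-filter-¬ as))

  length-filter-split : {Q : A → Set} (Q? : Decidable Q) → ∀ as → length (filter Q? as) ≡
    length (filter Q? (filter P? as)) ℕ.+ length (filter Q? (filter (¬? ∘ P?) as))
  length-filter-split Q? [] = refl
  length-filter-split Q? (a ∷ as) with P? a
  ... | yes _ with Q? a
  ...   | yes _ = cong suc (length-filter-split Q? as)
  ...   | no _ = length-filter-split Q? as
  length-filter-split Q? (a ∷ as) | no _ with Q? a
  ...   | yes _ = trans (cong suc (length-filter-split Q? as)) (sym (ℕP.+-suc _ _))
  ...   | no _ = length-filter-split Q? as

∈⇒0<length : ∀ {A : Set} {a : A} {as} → a ∈ as → 0 ℕ.< length as
∈⇒0<length {as = _ ∷ _} _ = s≤s z≤n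

ldeg : ℤ → ClauseSet → ℕ
ldeg x G = length (filter (x ∈?_) G)

vdeg : ℤ → ClauseSet → ℕ
vdeg x G = ldeg x G ℕ.+ ldeg (- x) G

restrict : ℤ → ClauseSet → ClauseSet
restrict x = filter (λ C → ¬? (- x ∈? C))

ldeg-positive : C ∈ G → x ∈ C → 1 ≤ ldeg x G
ldeg-positive {x = x} C∈G x∈C = ∈⇒0<length (∈-filter⁺ (x ∈?_) C∈G x∈C)

ldeg-zero : (∀ C → C ∈ G → x ∉ C) → ldeg x G ≡ 0
ldeg-zero {G} {x} none = cong length (filter-none (x ∈?_) (All.tabulate (none _)))

vdeg-neg : ∀ x G → vdeg (- x) G ≡ vdeg x G
vdeg-neg x G rewrite ℤP.neg-involutive x = ℕP.+-comm (ldeg (- x) G) (ldeg x G)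

vdeg-abs : ∀ G → ∣ x ∣ ≡ ∣ y ∣ → vdeg x G ≡ vdeg y G
vdeg-abs {x} {y} G e with ∣x∣≡∣y∣⇒x≡±y x y e
... | inj₁ refl = refl
... | inj₂ refl = vdeg-neg y G

length-restrict : ∀ x G → ldeg (- x) G ℕ.+ length (restrict x G) ≡ length G
length-restrict x G = length-filter-¬ (- x ∈?_) G

vdeg≤length : (∀ C → C ∈ G → Con C) → vdeg x G ≤ length G
vdeg≤length {[]} con = z≤n
vdeg≤length {C ∷ G} {x} con with ih ← vdeg≤length {G} {x} (λ D → con D ∘ there) | x ∈? C | - x ∈? C
... | yes p | yes q = ⊥-elim (con C (here refl) x p q)
... | yes _ | no _ = s≤s ih
... | no _ | yes _ = subst (_≤ suc (length G)) (sym (ℕP.+-suc _ _)) (s≤s ih)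
... | no _ | no _ = ℕP.m≤n⇒m≤1+n ih

-- The restriction drops the clauses containing `- x`, and each of these, being consistent,
-- contributes at most one to the degree of `w`.
vdeg-restrict : (∀ C → C ∈ G → Con C) → vdeg w G ≤ ldeg (- x) G ℕ.+ vdeg w (restrict x G)
vdeg-restrict {G} {w} {x} con = begin
  vdeg w G
    ≡⟨ cong₂ ℕ._+_ (length-filter-split (- x ∈?_) (w ∈?_) G)
                   (length-filter-split (- x ∈?_) (- w ∈?_) G) ⟩
  (ldeg w Gₓ ℕ.+ ldeg w (restrict x G)) ℕ.+ (ldeg (- w) Gₓ ℕ.+ ldeg (- w) (restrict x G))
    ≡⟨ ℕ+.interchange (ldeg w Gₓ) _ _ _ ⟩
  vdeg w Gₓ ℕ.+ vdeg w (restrict x G)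
    ≤⟨ ℕP.+-monoˡ-≤ _ (vdeg≤length (λ C → con C ∘ proj₁ ∘ ∈-filter⁻ (- x ∈?_))) ⟩
  ldeg (- x) G ℕ.+ vdeg w (restrict x G) ∎
  where
  open ℕP.≤-Reasoning
  Gₓ = filter (- x ∈?_) G

-- The clauses of G are to be read after falsifying Γ: no clause of G is
-- satisfied by this, and literals of Γ count as deleted.
record Split (Γ : List ℤ) (G : ClauseSet) (V : List ℕ) : Set where
  field
    conΓ    : Con Γ
    con     : ∀ C → C ∈ G → Con C
    compat  : ∀ C → C ∈ G → Compat C Γ
    hitting : Hitting G
    covers  : Covers Γ G
    unique  : Unique V
    fresh   : ∀ x → ∣ x ∣ ∈ V → x ∉ Γ
    occurs  : ∀ n → n ∈ V → ∃[ C ] ∃[ x ] (C ∈ G × x ∈ C × ∣ x ∣ ≡ n)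

-- Splitting on a variable of minimal degree

without : ℕ → List ℕ → List ℕ
without n = filter (λ m → ¬? (m ℕP.≟ n))

length-filter-≢ : ∀ {A : Set} (_≟_ : DecidableEquality A) {a as} → Unique as →
                  length as ≤ suc (length (filter (λ b → ¬? (b ≟ a)) as))
length-filter-≢ _≟_ [] = z≤n
length-filter-≢ _≟_ {a} {b ∷ as} (b∉as ∷ unique) with b ≟ a
... | yes refl = s≤s (ℕP.≤-reflexive (cong length (sym (filter-all _ (All.map (_∘ sym) b∉as)))))
... | no _ = s≤s (length-filter-≢ _≟_ unique)

length-without : ∀ {n V} → Unique V → length V ≤ suc (length (without n V))
length-without = length-filter-≢ ℕP._≟_

argmin : ∀ {A : Set} (f : A → ℕ) {a : A} {as} → a ∈ as → ∃[ m ] (m ∈ as × (∀ b → b ∈ as → f m ≤ f b))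
argmin f {as = a ∷ []} _ = a , here refl , λ { b (here refl) → ℕP.≤-refl }
argmin f {as = a ∷ a′ ∷ as} _ with argmin f {as = a′ ∷ as} (here refl)
... | m , m∈ , min with ℕP.≤-total (f a) (f m)
...   | inj₁ fa≤fm = a , here refl , λ where
          b (here refl) → ℕP.≤-refl
          b (there b∈) → ℕP.≤-trans fa≤fm (min b b∈)
...   | inj₂ fm≤fa = m , there m∈ , λ where
          b (here refl) → fm≤fa
          b (there b∈) → min b b∈

module _ {Γ G V} (split : Split Γ G V) where
  open Split split

  fresh-neg : ∣ x ∣ ∈ V → - x ∉ Γ
  fresh-neg {x} ∣x∣∈V = fresh (- x) (subst (_∈ V) (sym (ℤP.∣-i∣≡∣i∣ x)) ∣x∣∈V)

  -- Falsify `Γ` and all of `C` except `x`, which is made true; `mirror` then yields the clause.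
  neg-occurs : ∣ x ∣ ∈ V → C ∈ G → x ∈ C → ∃[ D ] (D ∈ G × - x ∈ D)
  neg-occurs {x} {C} ∣x∣∈V C∈G x∈C =
    let D , D∈G , -x∈D , _ = mirror hitting covers C∈G x∈C conS
                               (there ∘ ∈-++⁺ʳ (C ∖ x)) (there ∘ ∈-++⁺ˡ) (here refl)
    in D , D∈G , -x∈D
    where
    x∉ : x ∉ C ∖ x ++ Γ
    x∉ p with ∈-++⁻ (C ∖ x) p
    ... | inj₁ q = proj₂ (∖⁻ {C = C} q) refl
    ... | inj₂ q = fresh x ∣x∣∈V q
    con++ : Con (C ∖ x ++ Γ)
    con++ a p q with ∈-++⁻ (C ∖ x) p | ∈-++⁻ (C ∖ x) q
    ... | inj₁ p₁ | inj₁ q₁ = con C C∈G a (∖-⊑ p₁) (∖-⊑ q₁)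
    ... | inj₁ p₁ | inj₂ q₂ = compat C C∈G a (∖-⊑ p₁) q₂
    ... | inj₂ p₂ | inj₁ q₁ = compat-⊥ (compat C C∈G) (∖-⊑ q₁) p₂ refl
    ... | inj₂ p₂ | inj₂ q₂ = conΓ a p₂ q₂
    conS : Con (- x ∷ C ∖ x ++ Γ)
    conS = con-neg∷ (con⇒≢0 (con C C∈G) x∈C) x∉ con++

  literal-occurs : ∀ x → ∣ x ∣ ∈ V → ∃[ C ] (C ∈ G × x ∈ C)
  literal-occurs x ∣x∣∈V with occurs ∣ x ∣ ∣x∣∈V
  ... | C , y , C∈G , y∈C , e with ∣x∣≡∣y∣⇒x≡±y x y (sym e)
  ...   | inj₁ refl = C , C∈G , y∈C
  ...   | inj₂ refl = neg-occurs (subst (_∈ V) (sym e) ∣x∣∈V) C∈G y∈C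

  literal-degree : ∀ x → ∣ x ∣ ∈ V → 1 ≤ ldeg x G
  literal-degree x ∣x∣∈V = let C , C∈G , x∈C = literal-occurs x ∣x∣∈V in ldeg-positive C∈G x∈C

  nonzero : ∀ x → ∣ x ∣ ∈ V → x ≢ + 0
  nonzero x ∣x∣∈V = let C , C∈G , x∈C = literal-occurs x ∣x∣∈V in con⇒≢0 (con C C∈G) x∈C

  module _ (x : ℤ) (∣x∣∈V : ∣ x ∣ ∈ V) (min : ∀ n → n ∈ V → vdeg x G ≤ vdeg (+ n) G) where

    -- A variable n lost by the restriction would occur only in clauses
    -- containing - x, and so have smaller degree than x.
    occurs-restrict : ∀ n → n ∈ without ∣ x ∣ V →
                      ∃[ C ] ∃[ y ] (C ∈ restrict x G × y ∈ C × ∣ y ∣ ≡ n)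
    occurs-restrict n n∈ with any? (λ C → any? (λ y → ∣ y ∣ ℕP.≟ n) C) (restrict x G)
    ... | yes found with find found
    ...   | C , C∈ , foundC with find foundC
    ...     | y , y∈C , e = C , y , C∈ , y∈C , e
    occurs-restrict n n∈ | no none = ⊥-elim (ℕP.<⇒≱ bound (min n (proj₁ (∈-filter⁻ _ {xs = V} n∈))))
      where
      absent : ∀ y → ∣ y ∣ ≡ n → ldeg y (restrict x G) ≡ 0
      absent y e = ldeg-zero (λ C C∈ y∈C → none (lose C∈ (lose y∈C e)))
      bound : vdeg (+ n) G ℕ.< vdeg x G
      bound = begin-strict
        vdeg (+ n) G
          ≤⟨ vdeg-restrict {x = x} con ⟩
        ldeg (- x) G ℕ.+ vdeg (+ n) (restrict x G)
          ≡⟨ cong (ldeg (- x) G ℕ.+_) (cong₂ ℕ._+_ (absent (+ n) refl) (absent (- (+ n)) (ℤP.∣-i∣≡∣i∣ (+ n)))) ⟩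
        ldeg (- x) G ℕ.+ 0
          ≡⟨ ℕP.+-identityʳ _ ⟩
        ldeg (- x) G
          <⟨ ℕP.+-monoˡ-≤ (ldeg (- x) G) (literal-degree x ∣x∣∈V) ⟩
        vdeg x G ∎
        where open ℕP.≤-Reasoning

    -- Falsifying `x` satisfies exactly the clauses with `- x`. Minimality of the degree enters
    -- through `occurs-restrict`: every other variable survives.
    split-restrict : Split (x ∷ Γ) (restrict x G) (without ∣ x ∣ V)
    split-restrict = record
      { conΓ = con-∷ (nonzero x ∣x∣∈V) (fresh-neg ∣x∣∈V) conΓ
      ; con = λ C → con C ∘ inG
      ; compat = λ where
          C C∈ a a∈C (here e) → proj₂ (∈-filter⁻ _ {xs = G} C∈) (subst (_∈ C) (sym (-‿swap (sym e))) a∈C)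
          C C∈ a a∈C (there p) → compat C (inG C∈) a a∈C p
      ; hitting = λ C D C∈ D∈ → hitting C D (inG C∈) (inG D∈)
      ; covers = λ S conS Γ⊑S → let D , D∈G , cp = covers S conS (Γ⊑S ∘ there) in
          D , ∈-filter⁺ _ D∈G (λ -x∈D → compat-⊥ cp -x∈D (Γ⊑S (here refl)) refl) , cp
      ; unique = UniqueP.filter⁺ _ unique
      ; fresh = λ where
          y y∈ (here e) → proj₂ (∈-filter⁻ _ {xs = V} y∈) (cong ∣_∣ e)
          y y∈ (there p) → fresh y (proj₁ (∈-filter⁻ _ {xs = V} y∈)) p
      ; occurs = occurs-restrict
      }
      where
      inG : C ∈ restrict x G → C ∈ G
      inG = proj₁ ∘ ∈-filter⁻ _

    -- The split removes `ldeg (- x) G` clauses but at most one variable, so a positive deficiency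
    -- after it bounds the degree of `- x` before it.
    ldeg-bound : length (without ∣ x ∣ V) ℕ.< length (restrict x G) →
                 ldeg (- x) G ℕ.+ length V ≤ length G
    ldeg-bound V′<G′ = subst (ldeg (- x) G ℕ.+ length V ≤_) (length-restrict x G)
      (ℕP.+-monoʳ-≤ (ldeg (- x) G) (ℕP.≤-trans (length-without unique) V′<G′))

-- Induction on the number of variables, bounded by `n`: the split loses at least one clause, since
-- the complementary literal occurs, and at most one variable. Without variables, covering `Γ`
-- itself requires a clause.
tarsi : ∀ n {Γ G V} → length V ≤ n → Split Γ G V → length V ℕ.< length G
tarsi n {Γ} {V = []} _ split =
  let _ , D∈G , _ = Split.covers split Γ (Split.conΓ split) id in ∈⇒0<length D∈G
tarsi (suc n) {G = G} {V = V@(_ ∷ _)} V≤n split with argmin (λ m → vdeg (+ m) G) {as = V} (here refl)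
... | m , m∈V , min = ℕP.≤-trans
  (ℕP.+-monoˡ-≤ (length V) (literal-degree split (- (+ m)) (subst (_∈ V) (sym (ℤP.∣-i∣≡∣i∣ (+ m))) m∈V)))
  (ldeg-bound split (+ m) m∈V min (tarsi n V′≤n (split-restrict split (+ m) m∈V min)))
  where
  V′≤n : length (without m V) ≤ n
  V′≤n = ℕ.s≤s⁻¹ (ℕP.≤-trans (filter-notAll (λ a → ¬? (a ℕP.≟ m)) V (lose m∈V (λ ¬refl → ¬refl refl))) V≤n)

-- Degree bounds from the deficiency

module _ {Γ G V} (split : Split Γ G V) {k} (G≤V+k : length G ≤ k ℕ.+ length V)
         (n : ℕ) (n∈V : n ∈ V) (min : ∀ m → m ∈ V → vdeg (+ n) G ≤ vdeg (+ m) G) where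

  ldeg-neg≤deficiency : ∀ x → ∣ x ∣ ≡ n → ldeg (- x) G ≤ k
  ldeg-neg≤deficiency x refl = ℕP.+-cancelʳ-≤ (length V) _ _
    (ℕP.≤-trans (ldeg-bound split x n∈V min′ (tarsi _ ℕP.≤-refl (split-restrict split x n∈V min′))) G≤V+k)
    where
    min′ : ∀ m → m ∈ V → vdeg x G ≤ vdeg (+ m) G
    min′ m m∈V = subst (_≤ vdeg (+ m) G) (vdeg-abs {+ n} {x} G refl) (min m m∈V)

  ldeg≤deficiency : ∀ x → ∣ x ∣ ≡ n → ldeg x G ≤ k
  ldeg≤deficiency x e = subst (λ y → ldeg y G ≤ k) (ℤP.neg-involutive x)
    (ldeg-neg≤deficiency (- x) (trans (ℤP.∣-i∣≡∣i∣ x) e))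

deficiency-1 : ∀ {Γ G V n} → Split Γ G V → length G ≤ 1 ℕ.+ length V → n ∈ V →
               ∃[ m ] (m ∈ V × vdeg (+ m) G ≤ 2)
deficiency-1 {G = G} split G≤V+1 n∈V with argmin (λ m → vdeg (+ m) G) n∈V
... | m , m∈V , min = m , m∈V ,
  ℕP.+-mono-≤ (ldeg≤deficiency split G≤V+1 m m∈V min (+ m) refl)
              (ldeg-neg≤deficiency split G≤V+1 m m∈V min (+ m) refl)

-- If a minimal degree were 6, both literals would occur three times and the split would leave
-- deficiency at most 1. A variable of degree at most 2 there has degree at most 3 + 2 in `G`,
-- against minimality.
deficiency-3 : ∀ {Γ G V n} → Split Γ G V → length G ≤ 3 ℕ.+ length V → n ∈ V →
               ∃[ m ] (m ∈ V × ldeg (+ m) G ≤ 3 × ldeg (- (+ m)) G ≤ 3 × vdeg (+ m) G ≤ 5)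
deficiency-3 {G = G} {V = V} split G≤V+3 n∈V with argmin (λ m → vdeg (+ m) G) n∈V
... | m , m∈V , min =
  m , m∈V , pos≤3 , neg≤3 , [ id , (λ 6≤deg → ⊥-elim (impossible 6≤deg)) ]′ (ℕP.≤-<-connex (vdeg (+ m) G) 5)
  where
  open Split split
  V′ = without m V
  G′ = restrict (+ m) G
  pos≤3 : ldeg (+ m) G ≤ 3
  pos≤3 = ldeg≤deficiency split G≤V+3 m m∈V min (+ m) refl
  neg≤3 : ldeg (- (+ m)) G ≤ 3
  neg≤3 = ldeg-neg≤deficiency split G≤V+3 m m∈V min (+ m) refl
  impossible : 6 ≤ vdeg (+ m) G → ⊥
  impossible 6≤deg = lost-or-small V′ refl
    where
    3≤neg : 3 ≤ ldeg (- (+ m)) G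
    3≤neg = ℕP.+-cancelˡ-≤ 3 3 _ (ℕP.≤-trans 6≤deg (ℕP.+-monoˡ-≤ _ pos≤3))
    G′≤V : length G′ ≤ length V
    G′≤V = ℕP.+-cancelˡ-≤ 3 _ _ (ℕP.≤-trans (ℕP.+-monoˡ-≤ _ 3≤neg)
             (ℕP.≤-trans (ℕP.≤-reflexive (length-restrict (+ m) G)) G≤V+3))
    lost-or-small : ∀ W → W ≡ V′ → ⊥
    -- With no other variable there are at most 3 + 1 clauses, too few for degree 6.
    lost-or-small [] e = ℕP.<⇒≱ (ℕP.≤-trans 6≤deg (vdeg≤length {x = + m} con))
      (ℕP.≤-trans G≤V+3 (ℕP.≤-trans (ℕP.+-monoʳ-≤ 3 V≤1) (ℕP.m≤n+m 4 1)))
      where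
      V≤1 : length V ≤ 1
      V≤1 = subst (λ W → length V ≤ suc (length W)) (sym e) (length-without unique)
    lost-or-small (k ∷ _) e with deficiency-1 (split-restrict split (+ m) m∈V min)
      (ℕP.≤-trans G′≤V (length-without unique)) (subst (k ∈_) e (here refl))
    ... | w , w∈V′ , deg≤2 = ℕP.<⇒≱ (ℕP.≤-trans (s≤s bound) 6≤deg) (min w (proj₁ (∈-filter⁻ _ {xs = V} w∈V′)))
      where
      bound : vdeg (+ w) G ≤ 5
      bound = ℕP.≤-trans (vdeg-restrict {x = + m} con) (ℕP.+-mono-≤ neg≤3 deg≤2)

-- Total degree at most 5 excludes three occurrences of both literals; the sign is chosen so that
-- `x` is a rarer one.
light-literal : ∀ {Γ G V n} → Split Γ G V → length G ≤ 3 ℕ.+ length V → n ∈ V →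
                ∃[ x ] (1 ≤ ldeg x G × ldeg x G ≤ 2 × ldeg (- x) G ≤ 3)
light-literal {G = G} {V = V} split G≤V+3 n∈V with deficiency-3 split G≤V+3 n∈V
... | m , m∈V , pos≤3 , neg≤3 , deg≤5 with ℕP.≤-<-connex (ldeg (+ m) G) 2
...   | inj₁ pos≤2 = + m , literal-degree split (+ m) m∈V , pos≤2 , neg≤3
...   | inj₂ 3≤pos = - (+ m) ,
  literal-degree split (- (+ m)) (subst (_∈ V) (sym (ℤP.∣-i∣≡∣i∣ (+ m))) m∈V) ,
  ℕP.+-cancelˡ-≤ 3 _ _ (ℕP.≤-trans (ℕP.+-monoˡ-≤ _ 3≤pos) deg≤5) ,
  subst (λ x → ldeg x G ≤ 3) (sym (ℤP.neg-involutive (+ m))) pos≤3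

-- Literals of degree at most two

NfsReducible : ClauseSet → Set
NfsReducible F = ∃[ G ] (NfsFlips F G × ClauseReducible G)

-- C₁ and C₂ are the clauses containing x; those containing - x are sorted by
-- their literal over the variable of y, where K collects those without it.
record Config (F : ClauseSet) (x y y′ : ℤ) (C₁ C₂ : Clause) (K L₁ L₂ : ClauseSet) : Set where
  field
    y′≡-y : y′ ≡ - y
    C₁∈F  : C₁ ∈ F
    C₂∈F  : C₂ ∈ F
    x∈C₁  : x ∈ C₁
    x∈C₂  : x ∈ C₂
    y∈C₁  : y ∈ C₁
    y′∈C₂ : y′ ∈ C₂
    only  : ∀ D → D ∈ F → x ∈ D → D ≡ C₁ ⊎ D ≡ C₂
    K⊆F   : K ⊆ F
    inK   : ∀ D → D ∈ K → D ∈ F × - x ∈ D × y ∉ D × y′ ∉ D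
    inL₁  : ∀ D → D ∈ L₁ → D ∈ F × - x ∈ D × y ∈ D
    inL₂  : ∀ D → D ∈ L₂ → D ∈ F × - x ∈ D × y′ ∈ D
    sort  : ∀ D → D ∈ F → - x ∈ D → D ∈ K ⊎ D ∈ L₁ ⊎ D ∈ L₂
    L₁!   : Unique L₁
    L₂!   : Unique L₂

module _ {F : ClauseSet} (clauseSet : IsClauseSet F) (hit : Hitting F) (cov : Covers [] F) where

  conF : C ∈ F → Con C
  conF C∈F = proj₂ (proj₂ (All.lookup (proj₁ clauseSet) C∈F))

  reducible : ClauseReducible F → NfsReducible F
  reducible red = F , ε , red

  con-mirrored : C ∈ F → x ∈ C → Con (- x ∷ C ∖ x)
  con-mirrored {C} C∈F x∈C = con-neg∷ (con⇒≢0 (conF C∈F) x∈C)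
    (λ p → proj₂ (∖⁻ {C = C} p) refl) (con-⊑ ∖-⊑ (conF C∈F))

  mirror-neg : D ∈ F → - x ∈ D → Con S → D ∖ - x ⊑ S → x ∈ S → ∃[ E ] (E ∈ F × x ∈ E × Compat E S)
  mirror-neg {x = x} {S = S} D∈F -x∈D conS D⊑S x∈S =
    let E , E∈F , ⁻⁻x∈E , cp = mirror hit cov D∈F -x∈D conS (λ ()) D⊑S
                                 (subst (_∈ S) (sym (ℤP.neg-involutive x)) x∈S)
    in E , E∈F , subst (_∈ E) (ℤP.neg-involutive x) ⁻⁻x∈E , cp

  -- Two clashing clauses that cover the subcube of `Γ` cut it into two halves: `cover₂`, applied
  -- from either side, leaves room for the clashing literal only.
  complementary : ∀ {B C Γ} → B ∈ F → C ∈ F → B ≢ C → Con Γ → Γ ⊑ C → Compat B Γ → Covers Γ (B ∷ C ∷ []) →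
                  ∃[ z ] (z ∈ B × - z ∈ C × B ⊑ z ∷ Γ × C ⊑ - z ∷ Γ)
  complementary {B} {C} {Γ} B∈F C∈F B≢C conΓ Γ⊑C B∥Γ covΓ =
    let z , z∈B , -z∈C = hit B C B∈F C∈F B≢C
        z≡ = ℤP.neg-involutive z
    in z , z∈B , -z∈C , cover₂ covΓ conΓ (conF B∈F) z∈B -z∈C (B∥Γ z z∈B) ,
       cover₂ swapped conΓ (conF C∈F) -z∈C (subst (_∈ B) (sym z≡) z∈B)
         (λ p → conF C∈F z (Γ⊑C (subst (_∈ Γ) z≡ p)) -z∈C)
    where
    swapped : Covers Γ (C ∷ B ∷ [])
    swapped S conS Γ⊑S with covΓ S conS Γ⊑S
    ... | _ , here refl , cp = B , there (here refl) , cp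
    ... | _ , there (here refl) , cp = C , here refl , cp

  module _ {x y y′ C₁ C₂ K L₁ L₂} (config : Config F x y y′ C₁ C₂ K L₁ L₂) where
    open Config config

    -- Carrying `y′` with an equation, instead of writing `- y`, keeps this symmetry free of double
    -- negations.
    swap : Config F x y′ y C₂ C₁ K L₂ L₁
    swap = record
      { y′≡-y = sym (-‿swap y′≡-y)
      ; C₁∈F = C₂∈F ; C₂∈F = C₁∈F ; x∈C₁ = x∈C₂ ; x∈C₂ = x∈C₁ ; y∈C₁ = y′∈C₂ ; y′∈C₂ = y∈C₁
      ; only = λ D D∈F x∈D → [ inj₂ , inj₁ ]′ (only D D∈F x∈D)
      ; K⊆F = K⊆F
      ; inK = λ D D∈K → let D∈F , -x∈D , y∉D , y′∉D = inK D D∈K in D∈F , -x∈D , y′∉D , y∉D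
      ; inL₁ = inL₂ ; inL₂ = inL₁
      ; sort = λ D D∈F -x∈D → [ inj₁ , [ inj₂ ∘ inj₂ , inj₂ ∘ inj₁ ]′ ]′ (sort D D∈F -x∈D)
      ; L₁! = L₂! ; L₂! = L₁!
      }

    -- Serves both as the mirror image of `C₁` in `x` and as the assignment that makes `x` true and
    -- falsifies the rest of `C₁`.
    mirrored : List ℤ
    mirrored = - x ∷ C₁ ∖ x

    con₁ : Con mirrored
    con₁ = con-mirrored C₁∈F x∈C₁

    ∈-mirrored⁻ : ∀ {a} → a ∈ mirrored → a ≢ - x → a ∈ C₁
    ∈-mirrored⁻ (here e) a≢-x = ⊥-elim (a≢-x e)
    ∈-mirrored⁻ (there p) _ = ∖-⊑ p

    y≢x : y ≢ x
    y≢x refl = con-⊥ (conF C₂∈F) x∈C₂ y′∈C₂ y′≡-y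

    y∈mirrored : y ∈ mirrored
    y∈mirrored = there (∖⁺ y∈C₁ y≢x)

    x-clause≢ : ∀ {C D} → C ∈ F → x ∈ C → - x ∈ D → C ≢ D
    x-clause≢ C∈F x∈C -x∈D refl = conF C∈F x x∈C -x∈D

    -- Falsify D, x and y: the only clause that can be falsified is C₁.
    below : ∀ {a} → D ∈ F → - x ∈ D → y′ ∉ D → a ∈ C₁ → a ≢ x → a ≢ y → a ∈ D
    below {D} {a} D∈F -x∈D y′∉D a∈C₁ a≢x a≢y with a ∈? D
    ... | yes a∈D = a∈D
    ... | no a∉D with mirror-neg D∈F -x∈D conS (there ∘ there ∘ there) (there (here refl))
      where
      conF₁ = conF C₁∈F
      con-y : Con (y ∷ D ∖ - x)
      con-y = con-∷ (con⇒≢0 conF₁ y∈C₁) (y′∉D ∘ subst (_∈ D) (sym y′≡-y) ∘ ∖-⊑) (con-⊑ ∖-⊑ (conF D∈F))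
      con-x : Con (x ∷ y ∷ D ∖ - x)
      con-x = con-∷ (con⇒≢0 conF₁ x∈C₁)
        (λ { (here e) → con-⊥ conF₁ x∈C₁ y∈C₁ (sym e) ; (there p) → proj₂ (∖⁻ {C = D} p) refl }) con-y
      conS : Con (- a ∷ x ∷ y ∷ D ∖ - x)
      conS = con-neg∷ (con⇒≢0 conF₁ a∈C₁)
        (λ { (here e) → a≢x e ; (there (here e)) → a≢y e ; (there (there p)) → a∉D (∖-⊑ p) }) con-x
    ...   | E , E∈F , x∈E , cp with only E E∈F x∈E
    ...     | inj₁ refl = ⊥-elim (cp a a∈C₁ (here refl))
    ...     | inj₂ refl = ⊥-elim (compat-⊥ cp y′∈C₂ (there (there (here refl))) y′≡-y)

    below-mirrored : ∀ {a} → D ∈ F → - x ∈ D → y′ ∉ D → a ∈ mirrored → a ≡ y ⊎ a ∈ D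
    below-mirrored D∈F -x∈D y′∉D (here refl) = inj₂ -x∈D
    below-mirrored {a = a} D∈F -x∈D y′∉D (there p) with a ℤP.≟ y | ∖⁻ p
    ... | yes e | _ = inj₁ e
    ... | no a≢y | a∈C₁ , a≢x = inj₂ (below D∈F -x∈D y′∉D a∈C₁ a≢x a≢y)

    below-L₁ : D ∈ L₁ → mirrored ⊑ D
    below-L₁ {D} D∈L₁ a∈ with inL₁ D D∈L₁
    ... | D∈F , -x∈D , y∈D with below-mirrored D∈F -x∈D (λ y′∈D → con-⊥ (conF D∈F) y∈D y′∈D y′≡-y) a∈
    ...   | inj₁ refl = y∈D
    ...   | inj₂ a∈D = a∈D

    compat-K : D ∈ K → Compat D mirrored
    compat-K {D} D∈K a a∈D -a∈ with inK D D∈K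
    ... | D∈F , -x∈D , y∉D , y′∉D with below-mirrored D∈F -x∈D y′∉D -a∈
    ...   | inj₁ -a≡y = y′∉D (subst (_∈ D) (sym (trans y′≡-y (-‿swap (sym -a≡y)))) a∈D)
    ...   | inj₂ -a∈D = conF D∈F a a∈D -a∈D

    -- The clause given by `mirror` contains `- x`, and it is not in `L₂`, whose clauses are
    -- satisfied because `y` is false.
    covers-mirrored : Covers mirrored (K ++ L₁)
    covers-mirrored S conS ⊑S with mirror hit cov C₁∈F x∈C₁ conS (λ ()) (⊑S ∘ there) (⊑S (here refl))
    ... | D , D∈F , -x∈D , cp with sort D D∈F -x∈D
    ...   | inj₁ D∈K = D , ∈-++⁺ˡ D∈K , cp
    ...   | inj₂ (inj₁ D∈L₁) = D , ∈-++⁺ʳ K D∈L₁ , cp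
    ...   | inj₂ (inj₂ D∈L₂) =
      ⊥-elim (compat-⊥ cp (proj₂ (proj₂ (inL₂ D D∈L₂))) (⊑S y∈mirrored) y′≡-y)

    -- Only clauses of K can be falsified together with A = C₁ ∖ x ∖ y when y
    -- is false, and they do not depend on y.
    factor-K : 2 ≤ length K → L₁ ≡ [] → ClauseReducible F
    factor-K 2≤k refl = factor⇒reducible K⊆F (λ e → ℕP.<-irrefl (sym e) 2≤k) C₁∈F
      (λ C₁∈K → conF C₁∈F x x∈C₁ (proj₁ (proj₂ (inK C₁ C₁∈K))))
      (con-⊑ A⊑mirrored con₁)
      (λ D D∈K → conF (proj₁ (inK D D∈K)) , above D D∈K)
      coversA
      where
      A : List ℤ
      A = - x ∷ C₁ ∖ x ∖ y
      A⊑mirrored : A ⊑ mirrored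
      A⊑mirrored (here e) = here e
      A⊑mirrored (there p) = there (∖-⊑ p)
      above : ∀ D → D ∈ K → A ⊑ D
      above D D∈K (here refl) = proj₁ (proj₂ (inK D D∈K))
      above D D∈K (there p) =
        let D∈F , -x∈D , _ , y′∉D = inK D D∈K
            q , a≢y = ∖⁻ {C = C₁ ∖ x} p
            a∈C₁ , a≢x = ∖⁻ q
        in below D∈F -x∈D y′∉D a∈C₁ a≢x a≢y
      coversA : Covers A K
      -- Setting `y` to false makes the covering applicable. The clause found lies in `K`, hence
      -- lacks `y`, so putting `- y` back keeps it compatible.
      coversA S conS A⊑S with covers-mirrored (y ∷ S ∖ - y) con⁺ ⊑⁺
        where
        con⁺ : Con (y ∷ S ∖ - y)
        con⁺ = con-∷ (con⇒≢0 (conF C₁∈F) y∈C₁) (λ p → proj₂ (∖⁻ {C = S} p) refl) (con-⊑ ∖-⊑ conS)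
        ⊑⁺ : mirrored ⊑ y ∷ S ∖ - y
        ⊑⁺ (here refl) = there (∖⁺ (A⊑S (here refl)) (λ e → y≢x (sym (ℤP.neg-injective e))))
        ⊑⁺ {a} (there p) with a ℤP.≟ y
        ... | yes e = here e
        ... | no a≢y = there (∖⁺ (A⊑S (there (∖⁺ p a≢y))) (con-⊥ (conF C₁∈F) y∈C₁ (∖-⊑ p)))
      ... | D , D∈ , cp with ∈-++⁻ K D∈
      ...   | inj₁ D∈K = D , D∈K , λ a a∈D -a∈S → cp a a∈D (there (∖⁺ -a∈S (λ e →
        proj₁ (proj₂ (proj₂ (inK D D∈K))) (subst (_∈ D) (ℤP.neg-injective e) a∈D))))

  -- `D` alone covers the mirrored `C₁`, so it equals that mirror image.
  pair-mirror : ∀ {x y y′ C₁ C₂ L₂} → Config F x y y′ C₁ C₂ [] (D ∷ []) L₂ → ClauseReducible F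
  pair-mirror {D} {x} {C₁ = C₁} {C₂} config =
    pair⇒reducible C₁∈F D∈F C₂∈F
      (λ { refl → con-⊥ (conF C₁∈F) y∈C₁ y′∈C₂ y′≡-y }) (x-clause≢ config C₂∈F x∈C₂ -x∈D)
      (conF C₁∈F) (conF D∈F) x∈C₁ -x∈D (λ p → below-L₁ config (here refl) (there p))
      (λ p → let a∈D , a≢-x = ∖⁻ p in ∈-mirrored⁻ config (D⊑ a∈D) a≢-x)
    where
    open Config config
    D∈F = proj₁ (inL₁ D (here refl))
    -x∈D = proj₁ (proj₂ (inL₁ D (here refl)))
    D⊑ : D ⊑ mirrored config
    D⊑ = cover₁ (covers-mirrored config) (con₁ config) (conF D∈F)

  mirrored-K : ∀ {B x y y′ C₁ C₂ L₂} (config : Config F x y y′ C₁ C₂ (B ∷ []) [] L₂) → B ⊑ mirrored config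
  mirrored-K {B} config = cover₁ (covers-mirrored config) (con₁ config) (conF (proj₁ (inK B (here refl))))
    where open Config config

  -- `B` alone covers the mirror images of both `C₁` and `C₂`, so these two clauses agree with `B`
  -- away from the variables of `x` and `y` and differ only in the sign of `y`.
  pair-x : ∀ {B x y y′ C₁ C₂} → Config F x y y′ C₁ C₂ (B ∷ []) [] [] → ClauseReducible F
  pair-x {B} {x} {y} {y′} {C₁} {C₂} config =
    pair⇒reducible C₁∈F C₂∈F (proj₁ (inK B (here refl)))
      (λ e → x-clause≢ config C₁∈F x∈C₁ -x∈B (sym e)) (λ e → x-clause≢ config C₂∈F x∈C₂ -x∈B (sym e))
      (conF C₁∈F) (conF C₂∈F) y∈C₁ (subst (_∈ C₂) y′≡-y y′∈C₂)
      (⊑other config) (subst (λ z → C₂ ∖ z ⊑ C₁) y′≡-y (⊑other (swap config)))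
    where
    open Config config
    -x∈B = proj₁ (proj₂ (inK B (here refl)))
    ⊑other : ∀ {y y′ C₁ C₂} → Config F x y y′ C₁ C₂ (B ∷ []) [] [] → C₁ ∖ y ⊑ C₂
    ⊑other {y} {y′} {C₁} cfg {a} p with a ℤP.≟ x | ∖⁻ p
    ... | yes refl | _ = Config.x∈C₂ cfg
    ... | no a≢x | a∈C₁ , a≢y =
      let B∈F , _ , _ , y′∉B = Config.inK cfg B (here refl) in
      ∈-mirrored⁻ (swap cfg)
        (mirrored-K (swap cfg) (below cfg B∈F -x∈B y′∉B a∈C₁ a≢x a≢y))
        (con-⊥ (conF (Config.C₁∈F cfg)) (Config.x∈C₁ cfg) a∈C₁)

  -- Here B = - x ∪ A ∪ u and D = - x ∪ A ∪ {- u , y} for C₁ = A ∪ {x , y}, and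
  -- the flip produces - x ∪ A ∪ y, the mirror image of C₁.
  flip-L₁ : ∀ {B D x y y′ C₁ C₂ L₂} → Config F x y y′ C₁ C₂ (B ∷ []) (D ∷ []) L₂ → NfsReducible F
  flip-L₁ {B} {D} {x} {y} {y′} {C₁} config
    with Config.inK config B (here refl) | Config.inL₁ config D (here refl)
  ... | B∈F , -x∈B , y∉B , y′∉B | D∈F , -x∈D , y∈D
    with complementary B∈F D∈F (λ { refl → y∉B y∈D }) (con₁ config) (below-L₁ config (here refl))
           (compat-K config (here refl)) (covers-mirrored config)
  ... | z , z∈B , -z∈D , B⊑ , D⊑
    with flip clauseSet hit B∈F D∈F z∈B -z∈D y∈D y∉B (y′∉B ∘ subst (_∈ B) (sym (Config.y′≡-y config))) B∖z⊑D D⊑B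
    where
    B∖z⊑D : B ∖ z ⊑ D
    B∖z⊑D p with ∖⁻ p
    ... | a∈B , a≢z with B⊑ a∈B
    ...   | here e = ⊥-elim (a≢z e)
    ...   | there q = below-L₁ config (here refl) q
    D⊑B : D ∖ - z ∖ y ⊑ B
    D⊑B p with ∖⁻ {C = D ∖ - z} p
    ... | q , a≢y with ∖⁻ q
    ...   | a∈D , a≢-z with D⊑ a∈D
    ...     | here e = ⊥-elim (a≢-z e)
    ...     | there r with below-mirrored config B∈F -x∈B y′∉B r
    ...       | inj₁ e = ⊥-elim (a≢y e)
    ...       | inj₂ a∈B = a∈B
  ... | H , flips , conH , keep , Q₁∈H , Q₂∈H , Q₁∉F , Q₂∉F =
    H , flips , pair⇒reducible C₁∈H Q₂∈H Q₁∈H (λ { refl → Q₁∉F C₁∈F })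
      (λ e → conH _ Q₂∈H y (∈-canon⁺ (y ∷ B ∖ z) (here refl))
               (subst (- y ∈_) e (∈-canon⁺ (- y ∷ B) (here refl))))
      (conF C₁∈F) (conH _ Q₂∈H) x∈C₁ -x∈Q₂ C₁⊑Q₂ Q₂⊑C₁
    where
    open Config config
    C₁∈H : C₁ ∈ H
    C₁∈H = keep C₁ C₁∈F (x-clause≢ config C₁∈F x∈C₁ -x∈B) (x-clause≢ config C₁∈F x∈C₁ -x∈D)
    z∉D : z ∉ D
    z∉D z∈D = conF D∈F z z∈D -z∈D
    -x∈Q₂ : - x ∈ canon (y ∷ B ∖ z)
    -x∈Q₂ = ∈-canon⁺ (y ∷ B ∖ z) (there (∖⁺ -x∈B (λ { refl → z∉D -x∈D })))
    C₁⊑Q₂ : C₁ ∖ x ⊑ canon (y ∷ B ∖ z)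
    C₁⊑Q₂ {a} p with below-mirrored config B∈F -x∈B y′∉B (there p)
    ... | inj₁ e = ∈-canon⁺ (y ∷ B ∖ z) (here e)
    ... | inj₂ a∈B = ∈-canon⁺ (y ∷ B ∖ z) (there (∖⁺ a∈B (λ { refl → z∉D (below-L₁ config (here refl) (there p)) })))
    Q₂⊑C₁ : canon (y ∷ B ∖ z) ∖ - x ⊑ C₁
    Q₂⊑C₁ p with ∖⁻ {C = canon (y ∷ B ∖ z)} p
    ... | q , a≢-x with ∈-canon⁻ (y ∷ B ∖ z) q
    ...   | here refl = y∈C₁
    ...   | there r with ∖⁻ r
    ...     | a∈B , a≢z with B⊑ a∈B
    ...       | here e = ⊥-elim (a≢z e)
    ...       | there s = ∈-mirrored⁻ config s a≢-x

  -- Here B = - x ∪ A for C₁ = A ∪ {x , y}, and the flip adds y to B.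
  flip-K : ∀ {B D x y y′ C₁ C₂ L₂ z} → Config F x y y′ C₁ C₂ (B ∷ []) [] L₂ → D ∈ L₂ →
           z ∈ B → - z ∈ D → B ∖ z ⊑ D → D ∖ - z ∖ y′ ⊑ B → NfsReducible F
  flip-K {B} {D} {x} {y} {y′} {C₁} {z = z} config D∈L₂ z∈B -z∈D B⊑D D⊑B
    with Config.inK config B (here refl) | Config.inL₂ config D D∈L₂
  ... | B∈F , -x∈B , y∉B , y′∉B | D∈F , -x∈D , y′∈D
    with flip clauseSet hit B∈F D∈F z∈B -z∈D y′∈D y′∉B (y∉B ∘ subst (_∈ B) (-‿swap (Config.y′≡-y config))) B⊑D D⊑B
  ... | H , flips , conH , keep , Q₁∈H , Q₂∈H , Q₁∉F , Q₂∉F =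
    H , flips , pair⇒reducible C₁∈H Q₁∈H Q₂∈H (λ { refl → Q₂∉F C₁∈F })
      (λ e → conH _ Q₂∈H y′ (∈-canon⁺ (y′ ∷ B ∖ z) (here refl))
               (subst (- y′ ∈_) (sym e) (∈-canon⁺ (- y′ ∷ B) (here refl))))
      (conF C₁∈F) (conH _ Q₁∈H) x∈C₁ (∈-canon⁺ (- y′ ∷ B) (there -x∈B)) C₁⊑Q₁ Q₁⊑C₁
    where
    open Config config
    C₁∈H : C₁ ∈ H
    C₁∈H = keep C₁ C₁∈F (x-clause≢ config C₁∈F x∈C₁ -x∈B) (x-clause≢ config C₁∈F x∈C₁ -x∈D)
    C₁⊑Q₁ : C₁ ∖ x ⊑ canon (- y′ ∷ B)
    C₁⊑Q₁ p with below-mirrored config B∈F -x∈B y′∉B (there p)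
    ... | inj₁ refl = ∈-canon⁺ (- y′ ∷ B) (here (sym (-‿swap y′≡-y)))
    ... | inj₂ a∈B = ∈-canon⁺ (- y′ ∷ B) (there a∈B)
    Q₁⊑C₁ : canon (- y′ ∷ B) ∖ - x ⊑ C₁
    Q₁⊑C₁ p with ∖⁻ {C = canon (- y′ ∷ B)} p
    ... | q , a≢-x with ∈-canon⁻ (- y′ ∷ B) q
    ...   | here e = subst (_∈ C₁) (sym (trans e (-‿swap y′≡-y))) y∈C₁
    ...   | there a∈B = ∈-mirrored⁻ config (mirrored-K config a∈B) a≢-x

  module _ {B x y y′ C₁ C₂ L₂} (config : Config F x y y′ C₁ C₂ (B ∷ []) [] L₂) where
    open Config config

    private
      B∈F = proj₁ (inK B (here refl))
      -x∈B = proj₁ (proj₂ (inK B (here refl)))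
      y∉B = proj₁ (proj₂ (proj₂ (inK B (here refl))))
      y′∉B = proj₂ (proj₂ (proj₂ (inK B (here refl))))
      Γ₂ = mirrored (swap config)

    -- Falsifying `u` satisfies `E`, so `B` and `D` halve the remaining part of the mirrored `C₂`.
    complementary-L₂ : ∀ {D E u} → D ∈ L₂ → L₂ ⊑ D ∷ E ∷ [] → u ∈ D → - u ∈ E → - u ∉ B →
      ∃[ z ] (z ∈ B × - z ∈ D × B ⊑ z ∷ u ∷ Γ₂ × D ⊑ - z ∷ u ∷ Γ₂)
    complementary-L₂ {D} {E} {u} D∈L₂ L₂⊑ u∈D -u∈E -u∉B =
      complementary B∈F D∈F (λ { refl → y′∉B y′∈D })
        (con-∷ (con⇒≢0 (conF D∈F) u∈D) (conF D∈F u u∈D ∘ below-L₁ (swap config) D∈L₂) (con₁ (swap config)))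
        (λ { (here refl) → u∈D ; (there p) → below-L₁ (swap config) D∈L₂ p })
        (λ { a a∈B (here e) → -u∉B (subst (_∈ B) (sym (-‿swap (sym e))) a∈B)
           ; a a∈B (there p) → compat-K (swap config) (here refl) a a∈B p })
        covers-u
      where
      D∈F = proj₁ (inL₂ D D∈L₂)
      y′∈D = proj₂ (proj₂ (inL₂ D D∈L₂))
      covers-u : Covers (u ∷ Γ₂) (B ∷ D ∷ [])
      covers-u S conS ⊑S with covers-mirrored (swap config) S conS (⊑S ∘ there)
      ... | _ , here refl , cp = B , here refl , cp
      ... | C , there C∈L₂ , cp with L₂⊑ C∈L₂
      ...   | here refl = D , there (here refl) , cp
      ...   | there (here refl) = ⊥-elim (compat-⊥ cp -u∈E (⊑S (here refl)) refl)

    -- Since `u` is in both `B` and `D`, these differ only by their clash and by `y′`, which makes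
    -- them an nfs-pair.
    flip-K-of-three : ∀ {D E u} → D ∈ L₂ → L₂ ⊑ D ∷ E ∷ [] → u ∈ B → u ∈ D → - u ∈ E → NfsReducible F
    flip-K-of-three {D} {E} {u} D∈L₂ L₂⊑ u∈B u∈D -u∈E
      with complementary-L₂ D∈L₂ L₂⊑ u∈D -u∈E (conF B∈F u u∈B)
    ... | z , z∈B , -z∈D , B⊑ , D⊑ = flip-K config D∈L₂ z∈B -z∈D B⊑D D⊑B
      where
      B⊑D : B ∖ z ⊑ D
      B⊑D p with ∖⁻ p
      ... | a∈B , a≢z with B⊑ a∈B
      ...   | here e = ⊥-elim (a≢z e)
      ...   | there (here refl) = u∈D
      ...   | there (there q) = below-L₁ (swap config) D∈L₂ q
      D⊑B : D ∖ - z ∖ y′ ⊑ B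
      D⊑B p with ∖⁻ {C = D ∖ - z} p
      ... | q , a≢y′ with ∖⁻ q
      ...   | a∈D , a≢-z with D⊑ a∈D
      ...     | here e = ⊥-elim (a≢-z e)
      ...     | there (here refl) = u∈B
      ...     | there (there r) with below-mirrored (swap config) B∈F -x∈B y∉B r
      ...       | inj₁ e = ⊥-elim (a≢y′ e)
      ...       | inj₂ a∈B = a∈B

    -- `B` ignores the variable of `u`, so it is cut off by the same literal on both sides of it;
    -- hence `D` and `E` differ only in `u`.
    pair-L₂ : ∀ {D E u} → D ∈ L₂ → E ∈ L₂ → L₂ ⊑ D ∷ E ∷ [] → u ∈ D → - u ∈ E → u ∉ B → - u ∉ B →
              ClauseReducible F
    pair-L₂ {D} {E} {u} D∈L₂ E∈L₂ L₂⊑ u∈D -u∈E u∉B -u∉B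
      with complementary-L₂ D∈L₂ L₂⊑ u∈D -u∈E -u∉B
         | complementary-L₂ {u = - u} E∈L₂ L₂⊑′ -u∈E
             (subst (_∈ D) (sym (ℤP.neg-involutive u)) u∈D) (u∉B ∘ subst (_∈ B) (ℤP.neg-involutive u))
      where
      L₂⊑′ : L₂ ⊑ E ∷ D ∷ []
      L₂⊑′ p with L₂⊑ p
      ... | here e = there (here e)
      ... | there (here e) = here e
    ... | z , z∈B , -z∈D , _ , D⊑ | w , w∈B , -w∈E , B⊑ , E⊑ =
      pair⇒reducible D∈F E∈F C₁∈F (x-clause≢ config C₁∈F x∈C₁ -x∈D) (x-clause≢ config C₁∈F x∈C₁ -x∈E)
        (conF D∈F) (conF E∈F) u∈D -u∈E D⊑E E⊑D
      where
      D∈F = proj₁ (inL₂ D D∈L₂)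
      -x∈D = proj₁ (proj₂ (inL₂ D D∈L₂))
      E∈F = proj₁ (inL₂ E E∈L₂)
      -x∈E = proj₁ (proj₂ (inL₂ E E∈L₂))
      z≡w : z ≡ w
      -- On the side of `E`, `B` consists of `w` and mirrored literals; the latter lie in `D`, which
      -- contains `- z`.
      z≡w with B⊑ z∈B
      ... | here e = e
      ... | there (here refl) = ⊥-elim (-u∉B z∈B)
      ... | there (there p) = ⊥-elim (conF D∈F z (below-L₁ (swap config) D∈L₂ p) -z∈D)
      D⊑E : D ∖ u ⊑ E
      D⊑E p with ∖⁻ p
      ... | a∈D , a≢u with D⊑ a∈D
      ...   | here e = subst (_∈ E) (sym (trans e (cong -_ z≡w))) -w∈E
      ...   | there (here e) = ⊥-elim (a≢u e)
      ...   | there (there q) = below-L₁ (swap config) E∈L₂ q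
      E⊑D : E ∖ - u ⊑ D
      E⊑D p with ∖⁻ p
      ... | a∈E , a≢-u with E⊑ a∈E
      ...   | here e = subst (_∈ D) (sym (trans e (cong -_ (sym z≡w)))) -z∈D
      ...   | there (here e) = ⊥-elim (a≢-u e)
      ...   | there (there q) = below-L₁ (swap config) D∈L₂ q

  -- The case split is on how `B` meets the clash `u` of `D` and `E`; if `B` contains `- u`, the
  -- roles of `D` and `E` are exchanged.
  two-in-L₂ : ∀ {B D E x y y′ C₁ C₂} → Config F x y y′ C₁ C₂ (B ∷ []) [] (D ∷ E ∷ []) → NfsReducible F
  two-in-L₂ {B} {D} {E} config
    with Config.L₂! config | Config.inL₂ config D (here refl) | Config.inL₂ config E (there (here refl))
  ... | (D≢E ∷ []) ∷ _ | D∈F , _ | E∈F , _ with hit D E D∈F E∈F D≢E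
  ...   | u , u∈D , -u∈E with u ∈? B | - u ∈? B
  ...     | yes u∈B | _ = flip-K-of-three config (here refl) id u∈B u∈D -u∈E
  ...     | no _ | yes -u∈B = flip-K-of-three config (there (here refl))
              (λ { (here e) → there (here e) ; (there (here e)) → here e })
              -u∈B -u∈E (subst (_∈ D) (sym (ℤP.neg-involutive u)) u∈D)
  ...     | no u∉B | no -u∉B =
              reducible (pair-L₂ config (here refl) (there (here refl)) id u∈D -u∈E u∉B -u∉B)

  L₁-or-K-nonempty : ∀ {x y y′ C₁ C₂ L₂} → ¬ Config F x y y′ C₁ C₂ [] [] L₂
  L₁-or-K-nonempty config with covers-mirrored config (mirrored config) (con₁ config) id
  ... | _ , () , _

  -- With three clauses in all, an empty `K` leaves at most one clause in `L₁` or in `L₂`, and two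
  -- clauses in `K` leave `L₁` or `L₂` empty. A single clause in `K` needs the flips, apart from two
  -- cases of clause-factors.
  two-occurrences : ∀ {x y y′ C₁ C₂ K L₁ L₂} → Config F x y y′ C₁ C₂ K L₁ L₂ →
                    length K ℕ.+ (length L₁ ℕ.+ length L₂) ≤ 3 → NfsReducible F
  two-occurrences {K = []} {[]} config _ = ⊥-elim (L₁-or-K-nonempty config)
  two-occurrences {K = []} {_ ∷ []} config _ = reducible (pair-mirror config)
  two-occurrences {K = []} {_ ∷ _ ∷ _} {[]} config _ = ⊥-elim (L₁-or-K-nonempty (swap config))
  two-occurrences {K = []} {_ ∷ _ ∷ _} {_ ∷ []} config _ = reducible (pair-mirror (swap config))
  two-occurrences {K = []} {_ ∷ _ ∷ L₁} {_ ∷ _ ∷ _} config (s≤s (s≤s p)) with ℕP.m+n≤o⇒n≤o (length L₁) p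
  ... | s≤s ()
  two-occurrences {K = _ ∷ []} {[]} {[]} config _ = reducible (pair-x config)
  two-occurrences {K = _ ∷ []} {[]} {_ ∷ []} config _ = flip-L₁ (swap config)
  two-occurrences {K = _ ∷ []} {[]} {_ ∷ _ ∷ []} config _ = two-in-L₂ config
  two-occurrences {K = _ ∷ []} {[]} {_ ∷ _ ∷ _ ∷ _} config (s≤s (s≤s (s≤s ())))
  two-occurrences {K = _ ∷ []} {_ ∷ []} config _ = flip-L₁ config
  two-occurrences {K = _ ∷ []} {_ ∷ _ ∷ []} {[]} config _ = two-in-L₂ (swap config)
  two-occurrences {K = _ ∷ []} {_ ∷ _ ∷ []} {_ ∷ _} config (s≤s (s≤s (s≤s ())))
  two-occurrences {K = _ ∷ []} {_ ∷ _ ∷ _ ∷ _} config (s≤s (s≤s (s≤s ())))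
  two-occurrences {K = _ ∷ _ ∷ _} {[]} config _ = reducible (factor-K config (s≤s (s≤s z≤n)) refl)
  two-occurrences {K = _ ∷ _ ∷ _} {_ ∷ _} {[]} config _ = reducible (factor-K (swap config) (s≤s (s≤s z≤n)) refl)
  two-occurrences {K = _ ∷ _ ∷ K} {_ ∷ L₁} {_ ∷ _} config (s≤s (s≤s p)) with ℕP.m+n≤o⇒n≤o (length K) p
  ... | s≤s q with ℕP.m+n≤o⇒n≤o (length L₁) q
  ...   | ()

  -- `y` is a clash between the two clauses containing `x`, which exists by hitting.
  find-config : ∀ {x C₁ C₂} → filter (x ∈?_) F ≡ C₁ ∷ C₂ ∷ [] → ldeg (- x) F ≤ 3 → NfsReducible F
  find-config {x} {C₁} {C₂} eq neg≤3
    with ∈-filter⁻ (x ∈?_) {xs = F} (subst (C₁ ∈_) (sym eq) (here refl))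
       | ∈-filter⁻ (x ∈?_) {xs = F} (subst (C₂ ∈_) (sym eq) (there (here refl)))
       | subst Unique eq (UniqueP.filter⁺ (x ∈?_) (proj₂ clauseSet))
  ... | C₁∈F , x∈C₁ | C₂∈F , x∈C₂ | (C₁≢C₂ ∷ []) ∷ _ with hit C₁ C₂ C₁∈F C₂∈F C₁≢C₂
  ...   | y , y∈C₁ , -y∈C₂ = two-occurrences config (subst (_≤ 3) size neg≤3)
    where
    N M K L₁ L₂ : ClauseSet
    N = filter (- x ∈?_) F
    L₁ = filter (y ∈?_) N
    M = filter (¬? ∘ (y ∈?_)) N
    L₂ = filter (- y ∈?_) M
    K = filter (¬? ∘ (- y ∈?_)) M
    inN : D ∈ N → D ∈ F × - x ∈ D
    inN = ∈-filter⁻ (- x ∈?_)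
    inM : D ∈ M → D ∈ N × y ∉ D
    inM = ∈-filter⁻ (¬? ∘ (y ∈?_))
    N! : Unique N
    N! = UniqueP.filter⁺ (- x ∈?_) (proj₂ clauseSet)
    config : Config F x y (- y) C₁ C₂ K L₁ L₂
    config = record
      { y′≡-y = refl
      ; C₁∈F = C₁∈F ; C₂∈F = C₂∈F ; x∈C₁ = x∈C₁ ; x∈C₂ = x∈C₂ ; y∈C₁ = y∈C₁ ; y′∈C₂ = -y∈C₂
      ; only = only
      ; K⊆F = ⊆-trans (filter-⊆ _ M) (⊆-trans (filter-⊆ _ N) (filter-⊆ _ F))
      ; inK = λ D D∈K → let D∈M , -y∉D = ∈-filter⁻ (¬? ∘ (- y ∈?_)) {xs = M} D∈K
                            D∈N , y∉D = inM D∈M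
                            D∈F , -x∈D = inN D∈N
                        in D∈F , -x∈D , y∉D , -y∉D
      ; inL₁ = λ D D∈L₁ → let D∈N , y∈D = ∈-filter⁻ (y ∈?_) {xs = N} D∈L₁
                              D∈F , -x∈D = inN D∈N
                          in D∈F , -x∈D , y∈D
      ; inL₂ = λ D D∈L₂ → let D∈M , -y∈D = ∈-filter⁻ (- y ∈?_) {xs = M} D∈L₂
                              D∈F , -x∈D = inN (proj₁ (inM D∈M))
                          in D∈F , -x∈D , -y∈D
      ; sort = sort
      ; L₁! = UniqueP.filter⁺ (y ∈?_) N!
      ; L₂! = UniqueP.filter⁺ (- y ∈?_) (UniqueP.filter⁺ (¬? ∘ (y ∈?_)) N!)
      }
      where
      only : ∀ D → D ∈ F → x ∈ D → D ≡ C₁ ⊎ D ≡ C₂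
      only D D∈F x∈D with subst (D ∈_) eq (∈-filter⁺ (x ∈?_) D∈F x∈D)
      ... | here e = inj₁ e
      ... | there (here e) = inj₂ e
      sort : ∀ D → D ∈ F → - x ∈ D → D ∈ K ⊎ D ∈ L₁ ⊎ D ∈ L₂
      sort D D∈F -x∈D with y ∈? D | - y ∈? D | ∈-filter⁺ (- x ∈?_) D∈F -x∈D
      ... | yes y∈D | _ | D∈N = inj₂ (inj₁ (∈-filter⁺ (y ∈?_) D∈N y∈D))
      ... | no y∉D | yes -y∈D | D∈N =
        inj₂ (inj₂ (∈-filter⁺ (- y ∈?_) (∈-filter⁺ (¬? ∘ (y ∈?_)) D∈N y∉D) -y∈D))
      ... | no y∉D | no -y∉D | D∈N =
        inj₁ (∈-filter⁺ (¬? ∘ (- y ∈?_)) (∈-filter⁺ (¬? ∘ (y ∈?_)) D∈N y∉D) -y∉D)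
    size : length N ≡ length K ℕ.+ (length L₁ ℕ.+ length L₂)
    size = begin
      length N                                    ≡⟨ length-filter-¬ (y ∈?_) N ⟨
      length L₁ ℕ.+ length M                      ≡⟨ cong (length L₁ ℕ.+_) (length-filter-¬ (- y ∈?_) M) ⟨
      length L₁ ℕ.+ (length L₂ ℕ.+ length K)      ≡⟨ ℕP.+-assoc (length L₁) _ _ ⟨
      length L₁ ℕ.+ length L₂ ℕ.+ length K        ≡⟨ ℕP.+-comm _ (length K) ⟩
      length K ℕ.+ (length L₁ ℕ.+ length L₂)      ∎
      where open ≡-Reasoning

  -- Literals of degree one

  third-clause : 3 ≤ length F → ∀ P Q → ∃[ R ] (R ∈ F × R ≢ P × R ≢ Q)
  third-clause 3≤F P Q with filter (λ C → ¬? (C ≟ᶜ Q)) F₁ in eq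
    where F₁ = filter (λ C → ¬? (C ≟ᶜ P)) F
  ... | R ∷ _ =
    let R∈F₁ , R≢Q = ∈-filter⁻ (λ C → ¬? (C ≟ᶜ Q)) {xs = filter (λ C → ¬? (C ≟ᶜ P)) F}
                       (subst (R ∈_) (sym eq) (here refl))
        R∈F , R≢P = ∈-filter⁻ (λ C → ¬? (C ≟ᶜ P)) {xs = F} R∈F₁
    in R , R∈F , R≢P , R≢Q
  ... | [] with ℕP.≤-trans 3≤F (ℕP.≤-trans (length-filter-≢ _≟ᶜ_ {P} (proj₂ clauseSet))
                 (s≤s (length-filter-≢ _≟ᶜ_ {Q} (UniqueP.filter⁺ (λ C → ¬? (C ≟ᶜ P)) (proj₂ clauseSet)))))
  ...   | bound rewrite eq with bound
  ...     | s≤s (s≤s ())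

  -- The clauses with `- x` cover the mirror image of `C` and all contain it, so they form a
  -- clause-factor.
  one-occurrence : ∀ {x C} → 3 ≤ length F → filter (x ∈?_) F ≡ C ∷ [] → ClauseReducible F
  one-occurrence {x} {C} 3≤F eq
    with ∈-filter⁻ (x ∈?_) {xs = F} (subst (C ∈_) (sym eq) (here refl))
  ... | C∈F , x∈C = conclude N refl
    where
    N : ClauseSet
    N = filter (- x ∈?_) F
    Γₓ : List ℤ
    Γₓ = - x ∷ C ∖ x
    inN : D ∈ N → D ∈ F × - x ∈ D
    inN = ∈-filter⁻ (- x ∈?_)
    conΓₓ : Con Γₓ
    conΓₓ = con-mirrored C∈F x∈C
    coversΓₓ : Covers Γₓ N
    coversΓₓ S conS Γₓ⊑S =
      let D , D∈F , -x∈D , cp = mirror hit cov C∈F x∈C conS (λ ()) (Γₓ⊑S ∘ there) (Γₓ⊑S (here refl))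
      in D , ∈-filter⁺ (- x ∈?_) D∈F -x∈D , cp
    Γₓ⊑N : ∀ D → D ∈ N → Γₓ ⊑ D
    Γₓ⊑N D D∈N (here refl) = proj₂ (inN D∈N)
    -- If `D` lacked `a`, make `a` true, `x` false and the rest of `D` false: mirroring `D` forces a
    -- clause with `x`, but `C` is the only one and is satisfied by `a`.
    Γₓ⊑N D D∈N {a} (there p) with a ∈? D | inN D∈N | ∖⁻ p
    ... | yes a∈D | _ | _ = a∈D
    ... | no a∉D | D∈F , -x∈D | a∈C , a≢x
      with mirror-neg D∈F -x∈D
             (con-neg∷ (con⇒≢0 (conF C∈F) a∈C) (λ { (here e) → a≢x e ; (there q) → a∉D (∖-⊑ q) })
               (con-∷ (con⇒≢0 (conF C∈F) x∈C) (λ q → proj₂ (∖⁻ {C = D} q) refl) (con-⊑ ∖-⊑ (conF D∈F))))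
             (there ∘ there) (there (here refl))
    ...   | E , E∈F , x∈E , cp with subst (E ∈_) eq (∈-filter⁺ (x ∈?_) E∈F x∈E)
    ...     | here refl = ⊥-elim (cp a a∈C (here refl))
    conclude : ∀ N′ → N ≡ N′ → ClauseReducible F
    conclude [] e with subst (Covers Γₓ) e coversΓₓ Γₓ conΓₓ id
    ... | _ , () , _
    -- A single clause would be a trivial factor; here it is the mirror image of `C`, so `C` and `D`
    -- together are used.
    conclude (D ∷ []) e =
      let D∈N = subst (D ∈_) (sym e) (here refl)
          D∈F , -x∈D = inN D∈N
          R , R∈F , R≢C , R≢D = third-clause 3≤F C D
      in pair⇒reducible C∈F D∈F R∈F R≢C R≢D (conF C∈F) (conF D∈F) x∈C -x∈D (λ p → Γₓ⊑N D D∈N (there p))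
           (λ p → let a∈D , a≢-x = ∖⁻ p in
             [ (λ e → ⊥-elim (a≢-x e)) , ∖-⊑ ]′ (uncons (cover₁ (subst (Covers Γₓ) e coversΓₓ) conΓₓ (conF D∈F) a∈D)))
      where
      uncons : ∀ {a b : ℤ} {as} → a ∈ b ∷ as → a ≡ b ⊎ a ∈ as
      uncons (here e) = inj₁ e
      uncons (there p) = inj₂ p
    conclude (D ∷ E ∷ N′) e =
      factor⇒reducible (filter-⊆ (- x ∈?_) F) (λ len → absurd (trans (cong length (sym e)) len)) C∈F
        (λ C∈N → conF C∈F x x∈C (proj₂ (inN C∈N))) conΓₓ
        (λ D D∈N → conF (proj₁ (inN D∈N)) , Γₓ⊑N D D∈N) coversΓₓ
      where
      absurd : suc (suc (length N′)) ≢ 1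
      absurd ()

  literal-reducible : 3 ≤ length F → 1 ≤ ldeg x F → ldeg x F ≤ 2 → ldeg (- x) F ≤ 3 → NfsReducible F
  literal-reducible {x} 3≤F 1≤pos pos≤2 neg≤3 with filter (x ∈?_) F in eq
  ... | _ ∷ [] = reducible (one-occurrence 3≤F eq)
  ... | _ ∷ _ ∷ [] = find-config eq neg≤3
  literal-reducible 3≤F 1≤pos (s≤s (s≤s ())) neg≤3 | _ ∷ _ ∷ _ ∷ _

-- Clause-sets of deficiency three

length≡3+nVars : ∀ F → deficiency F ≡ + 3 → length F ≡ 3 ℕ.+ nVars F
length≡3+nVars F δ≡3 = ℤP.+-injective (begin
  + length F                                     ≡⟨ ℤP.+-identityʳ _ ⟨
  + length F ℤ.+ + 0                             ≡⟨ cong (ℤ._+_ (+ length F)) (ℤP.+-inverseˡ (+ nVars F)) ⟨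
  + length F ℤ.+ (- (+ nVars F) ℤ.+ + nVars F)   ≡⟨ ℤP.+-assoc (+ length F) (- (+ nVars F)) (+ nVars F) ⟨
  deficiency F ℤ.+ + nVars F                     ≡⟨ cong (ℤ._+ + nVars F) δ≡3 ⟩
  + (3 ℕ.+ nVars F)                              ∎)
  where open ≡-Reasoning

∈-varList : C ∈ F → x ∈ C → ∣ x ∣ ∈ varList F
∈-varList C∈F x∈C = ∈-deduplicate⁺ ℕP._≟_ (∈-map⁺ ∣_∣ (∈-concat⁺′ x∈C C∈F))

split-all : IsClauseSet F → Hitting F → Unsatisfiable F → Split [] F (varList F)
split-all {F} (clauses , _) hit unsat = record
  { conΓ = λ _ ()
  ; con = λ C C∈F → proj₂ (proj₂ (All.lookup clauses C∈F))
  ; compat = λ _ _ _ _ ()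
  ; hitting = hit
  ; covers = unsat⇒covers unsat
  ; unique = deduplicate-! (map ∣_∣ (concat F))
  ; fresh = λ _ _ ()
  ; occurs = occurs
  }
  where
  occurs : ∀ n → n ∈ varList F → ∃[ C ] ∃[ x ] (C ∈ F × x ∈ C × ∣ x ∣ ≡ n)
  occurs n n∈ with ∈-map⁻ ∣_∣ (∈-deduplicate⁻ ℕP._≟_ (map ∣_∣ (concat F)) n∈)
  ... | x , x∈ , e with ∈-concat⁻′ F x∈
  ...   | C , x∈C , C∈F = C , x , C∈F , x∈C , sym e

variable-exists : IsClauseSet F → Hitting F → 2 ≤ length F → ∃[ n ] (n ∈ varList F)
variable-exists {C ∷ D ∷ F} (_ , (C≢D ∷ _) ∷ _) hit _ =
  let x , x∈C , _ = hit C D (here refl) (there (here refl)) C≢D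
  in ∣ x ∣ , ∈-varList {F = C ∷ D ∷ F} (here refl) x∈C
variable-exists {_ ∷ []} _ _ (s≤s ())

theorem3 : ∀ (F : ClauseSet) → IsClauseSet F → Hitting F → Unsatisfiable F
    → ClauseIrreducible F → deficiency F ≡ + 3
    → ∃[ G ] (NfsFlips F G × ClauseReducible G)
theorem3 F clauseSet hit unsat _ δ≡3 =
  let n , n∈V = variable-exists clauseSet hit (ℕP.≤-trans (ℕP.n≤1+n 2) 3≤F)
      x , 1≤pos , pos≤2 , neg≤3 = light-literal (split-all clauseSet hit unsat) (ℕP.≤-reflexive lengthF) n∈V
  in literal-reducible clauseSet hit (unsat⇒covers unsat) {x} 3≤F 1≤pos pos≤2 neg≤3
  where
  lengthF : length F ≡ 3 ℕ.+ nVars F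
  lengthF = length≡3+nVars F δ≡3
  3≤F : 3 ≤ length F
  3≤F = subst (3 ≤_) (sym lengthF) (ℕP.m≤m+n 3 (nVars F))
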